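{- There is an absolute constant $C>0$ such that the following holds. Let $n\ge 2$ and let $f:\{0,1\}^n\to\{0,1\}$ be a read-once DNF formula. Under unit costs ($c_i=1$ for all $i$) and the uniform distribution ($p_i=1/2$ for all $i$), there is a non-adaptive strategy $S$ with $$\mathrm{cost}_{c,p}(f,S)\le C\log n\cdot \mathsf{OPT}_{\mathcal A}(f,c,p).$$
   Context: Stochastic Boolean Function Evaluation (SBFE) setup: $f:\{0,1\}^n\to\{0,1\}$ is a known Boolean function, $c\in\mathbb{R}_{>0}^n$ a cost vector and $p\in(0,1)^n$ a probability vector. The unknown input $x\in\{0,1\}^n$ is random with independent coordinates and $\Pr(x_i=1)=p_i$ (written $x\sim p$). The value $x_i$ can only be learned by testing variable $i$, at cost $c_i$. A strategy tests variables sequentially until $f(x)$ is determined, i.e. until $f(x')=f(x)$ for every $x'\in\{0,1\}^n$ agreeing with $x$ on all tested coordinates. An adaptive strategy is a decision tree (the next test may depend on previous outcomes); a non-adaptive strategy is a fixed permutation of $[n]$, with variables tested in that order until $f(x)$ is determined. $\mathrm{cost}_c(f,x,S)$ is the total cost of the tests performed by $S$ on input $x$, and $\mathrm{cost}_{c,p}(f,S)=\mathbb{E}_{x\sim p}[\mathrm{cost}_c(f,x,S)]$. $\mathsf{OPT}_{\mathcal A}(f,c,p)$ (resp. $\mathsf{OPT}_{\mathcal N}(f,c,p)$) is the minimum of $\mathrm{cost}_{c,p}(f,S)$ over all adaptive (resp. non-adaptive) strategies $S$. A DNF formula is a disjunction $T_1\vee\dots\vee T_m$ of terms, each a conjunction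 of literals (variables or negated variables); it is read-once if no variable is negated and distinct terms contain disjoint sets of variables. -}

module Defs where

open import Data.Bool.Base using (Bool; true; false; not; if_then_else_)
open import Data.Bool.ListAction using (any; all)
import Data.Bool.Properties as Bool
open import Data.Fin.Base using (Fin; zero; suc)
open import Data.Fin.Permutation using (Permutation′; _⟨$⟩ʳ_)
import Data.Fin.Properties as Fin
open import Data.Integer.Base using (+_)
open import Data.List.Base as List using (List; []; _∷_; _++_; [_]; foldr; concatMap; cartesianProductWith; allFin)
open import Data.List.Membership.Propositional using (_∈_; lose)
open import Data.List.Membership.Propositional.Properties using (∈-++⁺ˡ; ∈-++⁺ʳ; ∈-map⁺; ∈-allFin; ∈-concatMap⁺; ∈-cartesianProductWith⁺)
import Data.List.Relation.Binary.Disjoint.Propositional as List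
open import Data.List.Relation.Unary.All as All using (All)
open import Data.List.Relation.Unary.AllPairs using (AllPairs)
open import Data.List.Relation.Unary.Any using (here)
open import Data.Maybe.Base using (Maybe; just; nothing)
import Data.Maybe.Properties as Maybe
import Data.Maybe.Relation.Unary.All as Maybe
open import Data.Nat.Base as ℕ using (ℕ; zero; suc; NonZero)
import Data.Nat.Properties as ℕ
open import Data.Product.Base using (∃; _×_; _,_; proj₁; proj₂)
open import Data.Rational.Base using (ℚ; 0ℚ; 1ℚ; _+_; _-_; _*_; _/_; _≤_)
open import Data.Rational.Properties using (≤-decTotalOrder)
open import Data.Vec.Base as Vec using (Vec; []; _∷_; lookup; _[_]≔_; replicate)
open import Data.Vec.Relation.Binary.Pointwise.Inductive using (Pointwise; []; _∷_; decidable)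
open import Relation.Binary.Bundles using (DecTotalOrder)
open import Relation.Binary.PropositionalEquality using (_≡_; refl; sym; trans; cong; cong₂; subst)
open import Relation.Nullary using (¬_; Dec; yes; no; does; contradiction; contradiction-irr)
open import Relation.Nullary.Decidable using (map′; _→-dec_; recompute)

open import Data.List.Extrema (DecTotalOrder.totalOrder ≤-decTotalOrder) using (argmin; f[argmin]≤f[xs])

private
  variable
    n : ℕ

infix 4 _⊒_ _⊒?_ _≤_·log₂_

Input : ℕ → Set
Input n = Vec Bool n

BoolFun : ℕ → Set
BoolFun n = Input n → Bool

inputs : ∀ n → List (Input n)
inputs zero    = [ [] ]
inputs (suc n) = List.map (false ∷_) (inputs n) ++ List.map (true ∷_) (inputs n)

inputs-complete : (x : Input n) → x ∈ inputs n
inputs-complete []          = here refl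
inputs-complete (false ∷ x) = ∈-++⁺ˡ (∈-map⁺ _ (inputs-complete x))
inputs-complete (true  ∷ x) = ∈-++⁺ʳ _ (∈-map⁺ _ (inputs-complete x))

Pr : Vec ℚ n → Input n → ℚ
Pr []      []      = 1ℚ
Pr (p ∷ q) (b ∷ x) = (if b then p else 1ℚ - p) * Pr q x

𝔼 : Vec ℚ n → (Input n → ℚ) → ℚ
𝔼 p g = foldr _+_ 0ℚ (List.map (λ x → Pr p x * g x) (inputs _))

-- `nothing` marks an untested variable, `just b` the outcome of its test.
Outcomes : ℕ → Set
Outcomes n = Vec (Maybe Bool) n

untested : Outcomes n
untested = replicate _ nothing

_⊒_ : Input n → Outcomes n → Set
x ⊒ ρ = Pointwise (λ b → Maybe.All (b ≡_)) x ρ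

_⊒?_ : (x : Input n) (ρ : Outcomes n) → Dec (x ⊒ ρ)
_⊒?_ = decidable (λ b → Maybe.dec (b Bool.≟_))

Determined : BoolFun n → Outcomes n → Set
Determined f ρ = ∀ x x′ → x ⊒ ρ → x′ ⊒ ρ → f x ≡ f x′

∀Input? : {P : Input n → Set} → (∀ x → Dec (P x)) → Dec (∀ x → P x)
∀Input? P? = map′ (λ ps x → All.lookup ps (inputs-complete x))
                  (λ p → All.tabulate (λ {x} _ → p x))
                  (All.all? P? (inputs _))

determined? : (f : BoolFun n) (ρ : Outcomes n) → Dec (Determined f ρ)
determined? f ρ = ∀Input? λ x → ∀Input? λ x′ →
  (x ⊒? ρ) →-dec ((x′ ⊒? ρ) →-dec (f x Bool.≟ f x′))

-- A decision tree for f continuing from the outcomes ρ; the first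
-- subtree of `test` is followed on outcome 0, the second on outcome 1.
-- The side conditions are irrelevant so that trees are equal when they
-- perform the same tests.
data Tree (f : BoolFun n) (ρ : Outcomes n) : Set where
  stop : .(Determined f ρ) → Tree f ρ
  test : (i : Fin n) → .(lookup ρ i ≡ nothing) → .(¬ Determined f ρ) →
         Tree f (ρ [ i ]≔ just false) → Tree f (ρ [ i ]≔ just true) →
         Tree f ρ

Adaptive : BoolFun n → Set
Adaptive f = Tree f untested

treeCost : {f : BoolFun n} {ρ : Outcomes n} → Vec ℚ n → Input n → Tree f ρ → ℚ
treeCost c x (stop _)           = 0ℚ
treeCost c x (test i _ _ t₀ t₁) =
  lookup c i + (if lookup x i then treeCost c x t₁ else treeCost c x t₀)

cost𝒜 : (f : BoolFun n) → Vec ℚ n → Vec ℚ n → Adaptive f → ℚ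
cost𝒜 f c p t = 𝔼 p (λ x → treeCost c x t)

NonAdaptive : ℕ → Set
NonAdaptive n = Permutation′ n

runCost : BoolFun n → Vec ℚ n → Input n → Outcomes n → List (Fin n) → ℚ
runCost f c x ρ []       = 0ℚ
runCost f c x ρ (i ∷ is) =
  if does (determined? f ρ) then 0ℚ
  else lookup c i + runCost f c x (ρ [ i ]≔ just (lookup x i)) is

cost𝒩 : BoolFun n → Vec ℚ n → Vec ℚ n → NonAdaptive n → ℚ
cost𝒩 f c p π =
  𝔼 p (λ x → runCost f c x untested (List.map (π ⟨$⟩ʳ_) (allFin _)))

private
  _≟nothing : (m : Maybe Bool) → Dec (m ≡ nothing)
  m ≟nothing = Maybe.≡-dec Bool._≟_ m nothing

  #untested : Outcomes n → ℕ
  #untested []            = 0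
  #untested (nothing ∷ ρ) = suc (#untested ρ)
  #untested (just _  ∷ ρ) = #untested ρ

  #untested≤n : (ρ : Outcomes n) → #untested ρ ℕ.≤ n
  #untested≤n []            = ℕ.z≤n
  #untested≤n (nothing ∷ ρ) = ℕ.s≤s (#untested≤n ρ)
  #untested≤n (just _  ∷ ρ) = ℕ.m≤n⇒m≤1+n (#untested≤n ρ)

  #untested-test : (ρ : Outcomes n) (i : Fin n) (b : Bool) → lookup ρ i ≡ nothing →
                   #untested ρ ≡ suc (#untested (ρ [ i ]≔ just b))
  #untested-test (nothing ∷ ρ) zero    b eq = refl
  #untested-test (nothing ∷ ρ) (suc i) b eq = cong suc (#untested-test ρ i b eq)
  #untested-test (just _  ∷ ρ) (suc i) b eq = #untested-test ρ i b eq

  fuel-test : ∀ {k} (ρ : Outcomes n) (i : Fin n) (b : Bool) → lookup ρ i ≡ nothing →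
              #untested ρ ℕ.≤ suc k → #untested (ρ [ i ]≔ just b) ℕ.≤ k
  fuel-test ρ i b eq le = ℕ.s≤s⁻¹ (subst (ℕ._≤ _) (#untested-test ρ i b eq) le)

  completion-unique : (ρ : Outcomes n) → ¬ (∃ λ i → lookup ρ i ≡ nothing) →
                      ∀ x x′ → x ⊒ ρ → x′ ⊒ ρ → x ≡ x′
  completion-unique []            h []      []        []                  []                   = refl
  completion-unique (nothing ∷ ρ) h _       _         _                   _                    = contradiction (zero , refl) h
  completion-unique (just b ∷ ρ)  h (a ∷ x) (a′ ∷ x′) (Maybe.just e ∷ es) (Maybe.just e′ ∷ es′) =
    cong₂ _∷_ (trans e (sym e′)) (completion-unique ρ (λ (i , eq) → h (suc i , eq)) x x′ es es′)

  untestedVariable : (f : BoolFun n) (ρ : Outcomes n) → ¬ Determined f ρ →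
                     ∃ λ i → lookup ρ i ≡ nothing
  untestedVariable f ρ ¬d with Fin.any? (λ i → lookup ρ i ≟nothing)
  ... | yes u = u
  ... | no ¬u = contradiction (λ x x′ a a′ → cong f (completion-unique ρ ¬u x x′ a a′)) ¬d

  someTree : (f : BoolFun n) (k : ℕ) (ρ : Outcomes n) → #untested ρ ℕ.≤ k → Tree f ρ
  someTree f k ρ le with determined? f ρ
  ... | yes d = stop d
  ... | no ¬d with untestedVariable f ρ ¬d
  ...   | i , eq with k
  ...     | zero  = contradiction (subst (ℕ._≤ 0) (#untested-test ρ i false eq) le) λ ()
  ...     | suc k = test i eq ¬d (someTree f k _ (fuel-test ρ i false eq le))
                                 (someTree f k _ (fuel-test ρ i true eq le))

  mutual
    trees : (f : BoolFun n) → ℕ → (ρ : Outcomes n) → List (Tree f ρ)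
    trees f k ρ = treesDec f k ρ (determined? f ρ)

    treesDec : (f : BoolFun n) → ℕ → (ρ : Outcomes n) → Dec (Determined f ρ) → List (Tree f ρ)
    treesDec f k       ρ (yes d) = [ stop d ]
    treesDec f zero    ρ (no ¬d) = []
    treesDec f (suc k) ρ (no ¬d) =
      concatMap (λ i → treesFrom f k ρ ¬d i (lookup ρ i ≟nothing)) (allFin _)

    treesFrom : (f : BoolFun n) → ℕ → (ρ : Outcomes n) → ¬ Determined f ρ →
                (i : Fin n) → Dec (lookup ρ i ≡ nothing) → List (Tree f ρ)
    treesFrom f k ρ ¬d i (yes eq) =
      cartesianProductWith (test i eq ¬d) (trees f k (ρ [ i ]≔ just false))
                                          (trees f k (ρ [ i ]≔ just true))
    treesFrom f k ρ ¬d i (no _)   = []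

  mutual
    trees-complete : (f : BoolFun n) (k : ℕ) (ρ : Outcomes n) → #untested ρ ℕ.≤ k →
                     (t : Tree f ρ) → t ∈ trees f k ρ
    trees-complete f k ρ le t = treesDec-complete f k ρ le t (determined? f ρ)

    treesDec-complete : (f : BoolFun n) (k : ℕ) (ρ : Outcomes n) → #untested ρ ℕ.≤ k →
                        (t : Tree f ρ) (d? : Dec (Determined f ρ)) → t ∈ treesDec f k ρ d?
    treesDec-complete f k       ρ le (stop _)         (yes _) = here refl
    treesDec-complete f k       ρ le (stop d)         (no ¬d) = contradiction-irr d ¬d
    treesDec-complete f k       ρ le (test _ _ ¬d _ _) (yes d) = contradiction-irr ¬d (λ ¬d → ¬d d)
    treesDec-complete f zero    ρ le (test i eq _ _ _) (no _) =
      contradiction (subst (ℕ._≤ 0) (#untested-test ρ i false (recompute (lookup ρ i ≟nothing) eq)) le) λ ()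
    treesDec-complete f (suc k) ρ le (test i eq ¬d′ t₀ t₁) (no ¬d) =
      ∈-concatMap⁺ (λ j → treesFrom f k ρ ¬d j (lookup ρ j ≟nothing))
        (lose (∈-allFin i) (treesFrom-complete f k ρ le ¬d i eq t₀ t₁ (lookup ρ i ≟nothing)))

    treesFrom-complete : (f : BoolFun n) (k : ℕ) (ρ : Outcomes n) → #untested ρ ℕ.≤ suc k →
                         (¬d : ¬ Determined f ρ) (i : Fin n) .(eq : lookup ρ i ≡ nothing) →
                         (t₀ : Tree f (ρ [ i ]≔ just false)) (t₁ : Tree f (ρ [ i ]≔ just true)) →
                         (u? : Dec (lookup ρ i ≡ nothing)) →
                         test i eq ¬d t₀ t₁ ∈ treesFrom f k ρ ¬d i u?
    treesFrom-complete f k ρ le ¬d i eq t₀ t₁ (no ¬eq) = contradiction-irr eq ¬eq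
    treesFrom-complete f k ρ le ¬d i eq t₀ t₁ (yes e) =
      ∈-cartesianProductWith⁺ (test i e ¬d)
        (trees-complete f k _ (fuel-test ρ i false e le) t₀)
        (trees-complete f k _ (fuel-test ρ i true e le) t₁)

allAdaptive : (f : BoolFun n) → List (Adaptive f)
allAdaptive {n} f = trees f n untested

allAdaptive-complete : (f : BoolFun n) (t : Adaptive f) → t ∈ allAdaptive f
allAdaptive-complete {n} f = trees-complete f n untested (#untested≤n {n} untested)

optimal : (f : BoolFun n) → Vec ℚ n → Vec ℚ n → Adaptive f
optimal {n} f c p = argmin (cost𝒜 f c p) (someTree f n untested (#untested≤n {n} untested)) (allAdaptive f)

-- The minimum over the finitely many decision trees for f, as witnessed
-- by OPT𝒜-attained and OPT𝒜-minimal.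
OPT𝒜 : BoolFun n → Vec ℚ n → Vec ℚ n → ℚ
OPT𝒜 f c p = cost𝒜 f c p (optimal f c p)

OPT𝒜-attained : (f : BoolFun n) (c p : Vec ℚ n) → ∃ λ (t : Adaptive f) → cost𝒜 f c p t ≡ OPT𝒜 f c p
OPT𝒜-attained f c p = optimal f c p , refl

OPT𝒜-minimal : (f : BoolFun n) (c p : Vec ℚ n) (t : Adaptive f) → OPT𝒜 f c p ≤ cost𝒜 f c p t
OPT𝒜-minimal f c p t = All.lookup (f[argmin]≤f[xs] _ (allAdaptive f)) (allAdaptive-complete f t)

data Literal (n : ℕ) : Set where
  pos neg : Fin n → Literal n

variableOf : Literal n → Fin n
variableOf (pos i) = i
variableOf (neg i) = i

Term : ℕ → Set
Term n = List (Literal n)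

DNF : ℕ → Set
DNF n = List (Term n)

⟦_⟧ˡ : Literal n → BoolFun n
⟦ pos i ⟧ˡ x = lookup x i
⟦ neg i ⟧ˡ x = not (lookup x i)

⟦_⟧ᵗ : Term n → BoolFun n
⟦ T ⟧ᵗ x = all (λ l → ⟦ l ⟧ˡ x) T

⟦_⟧ : DNF n → BoolFun n
⟦ φ ⟧ x = any (λ T → ⟦ T ⟧ᵗ x) φ

data Positive {n : ℕ} : Literal n → Set where
  pos : (i : Fin n) → Positive (pos i)

variables : Term n → List (Fin n)
variables = List.map variableOf

record ReadOnce (φ : DNF n) : Set where
  field
    positive : All (All Positive) φ
    disjoint : AllPairs (λ T T′ → List.Disjoint (variables T) (variables T′)) φ

-- For z ≥ 0 and n ≥ 1 this is the real inequality y ≤ z · log₂ n.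
-- A fraction a / b ≥ 0 is an upper bound of the real number log₂ n iff
-- n ^ b ≤ 2 ^ a, and y ≤ z · log₂ n holds iff y ≤ z · (a / b) for all
-- these a / b, because their infimum is log₂ n.
_≤_·log₂_ : ℚ → ℚ → ℕ → Set
y ≤ z ·log₂ n = ∀ (a b : ℕ) .{{_ : NonZero b}} → n ℕ.^ b ℕ.≤ 2 ℕ.^ a → y ≤ z * (+ a / b)

{-# OPTIONS --safe #-}

-- Sort the terms T₁, …, Tₘ by length and let V be the expected number of
-- terms that one looks at when each look reveals a whole term and the
-- search ends at the first satisfied one:
-- V = 1 + (1 − 2^-|T₁|) (1 + (1 − 2^-|T₂|) (1 + …)).
--
-- V ≤ OPT.  For partial outcomes ρ let a be the probability that no term
-- touched by ρ turns out satisfied, and let V′ be V for the untouched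
-- terms.  Then a·V′ bounds the expected remaining cost of every decision
-- tree from below: continuing a touched term keeps a·V′ constant on
-- average, and starting an untouched term T loses at most 1, because
-- V′ ≤ 1 + (1 − 2^-|T|) V″ with V″ belonging to the other untouched terms
-- (exchange T with the shorter terms before it).
--
-- Conversely, let n ≤ 2^L and test the first L variables of each term, in
-- order of length, and then everything else.  Each term looked at costs at
-- most L tests, plus a further n tests in the event, of probability
-- 2^-L ≤ 1/n, that the tested part of a term longer than L is satisfied.
-- The expected cost is at most (L + 1) V.

module Submission where

open import Defs
open import Data.Bool.Base as Bool using (Bool; true; false; if_then_else_; _∧_; _∨_)
open import Data.Bool.ListAction using (any; all)
open import Data.Bool.Properties as Bool using (∨-zeroʳ)
open import Data.Fin.Base using (Fin; zero; suc)
open import Data.Fin.Permutation as Perm using (Permutation; Permutation′; _⟨$⟩ʳ_)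
import Data.Fin.Properties as Fin
import Data.Integer.Base as ℤ
import Data.Integer.Properties as ℤ
open import Data.List.Base as List using (List; []; _∷_; _++_; foldr; length; take; concat; allFin; filter; deduplicate)
import Data.List.Membership.DecPropositional as DecMembership
open import Data.List.Membership.Propositional using (_∈_; _∉_; lose)
open import Data.List.Membership.Propositional.Properties using (∈-++⁺ˡ; ∈-++⁺ʳ; ∈-allFin; ∈-filter⁺; ∈-filter⁻; ∈-lookup; ∈-deduplicate⁻; ∈-deduplicate⁺)
import Data.List.Properties as List
open import Data.List.Relation.Binary.Disjoint.Propositional using (Disjoint)
open import Data.List.Relation.Binary.Permutation.Propositional using (_↭_; ↭-sym; ↭⇒↭ₛ)
open import Data.List.Relation.Binary.Permutation.Propositional.Properties using (All-resp-↭; Any-resp-↭)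
import Data.List.Relation.Binary.Permutation.Setoid.Properties as Permutationₛ
open import Data.List.Relation.Unary.All as All using (All; []; _∷_)
import Data.List.Relation.Unary.All.Properties as All
open import Data.List.Relation.Unary.AllPairs as AllPairs using (AllPairs; []; _∷_)
import Data.List.Relation.Unary.AllPairs.Properties as AllPairs
open import Data.List.Relation.Unary.Any as Any using (here; there)
import Data.List.Relation.Unary.Any.Properties as Any
import Data.List.Relation.Unary.Sorted.TotalOrder.Properties as Sorted
open import Data.List.Relation.Unary.Unique.DecPropositional.Properties using (deduplicate-!)
open import Data.List.Relation.Unary.Unique.Propositional using (Unique)
open import Data.List.Relation.Unary.Unique.Propositional.Properties as Unique using (Unique[x∷xs]⇒x∉xs)
open import Data.Maybe.Base using (Maybe; just; nothing; is-just; fromMaybe)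
import Data.Maybe.Properties as Maybe
import Data.Maybe.Relation.Unary.All as Maybe
open import Data.Nat.Base as ℕ using (ℕ; zero; suc; NonZero)
import Data.Nat.Properties as ℕ
open import Data.Product.Base using (Σ-syntax; ∃; _×_; _,_; proj₁; proj₂; swap)
open import Data.Rational.Base using (ℚ; 0ℚ; 1ℚ; ½; _<_; _≤_; _*_; _+_; _-_; _/_; nonNegative; toℚᵘ; -_)
open import Data.Rational.Properties as ℚ using (toℚᵘ-cancel-≤; toℚᵘ-fromℚᵘ; toℚᵘ-homo-+)
open import Data.Rational.Solver using (module +-*-Solver)
open import Data.Rational.Unnormalised.Base as ℚᵘ using (mkℚᵘ; *≤*; *≡*)
import Data.Rational.Unnormalised.Properties as ℚᵘ
open import Data.Vec.Base as Vec using ([]; _∷_; lookup; _[_]≔_; replicate)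
open import Data.Vec.Properties using (lookup∘update; lookup∘update′; lookup-map; lookup-replicate)
open import Data.Vec.Relation.Binary.Pointwise.Inductive using ([]; _∷_)
open import Function.Base using (_∘_; _on_)
open import Relation.Binary.Bundles using (DecTotalOrder)
import Relation.Binary.Construct.On as On
open import Relation.Binary.PropositionalEquality using (_≡_; refl; sym; trans; cong; cong₂; subst; subst₂; module ≡-Reasoning; _≢_; setoid; resp₂)
open import Relation.Nullary using (¬_; Dec; yes; no; contradiction; recompute; does; ¬?)

open +-*-Solver using (solve; _:+_; _:*_; _:-_; _:=_; con)

private
  variable
    n : ℕ

-- Rational inequalities.

*-mono-nonNegˡ : ∀ {r p q} → 0ℚ ≤ r → p ≤ q → r * p ≤ r * q
*-mono-nonNegˡ {r} 0≤r = ℚ.*-monoˡ-≤-nonNeg r {{nonNegative 0≤r}}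

*-mono-nonNegʳ : ∀ {r p q} → 0ℚ ≤ r → p ≤ q → p * r ≤ q * r
*-mono-nonNegʳ {r} 0≤r = ℚ.*-monoʳ-≤-nonNeg r {{nonNegative 0≤r}}

*-nonNeg : ∀ {p q} → 0ℚ ≤ p → 0ℚ ≤ q → 0ℚ ≤ p * q
*-nonNeg {p} {q} 0≤p 0≤q = subst (_≤ p * q) (ℚ.*-zeroʳ p) (*-mono-nonNegˡ 0≤p 0≤q)

*-≤1 : ∀ {p q} → 0ℚ ≤ p → p ≤ 1ℚ → q ≤ 1ℚ → p * q ≤ 1ℚ
*-≤1 {p} {q} 0≤p p≤1 q≤1 =
  ℚ.≤-trans (*-mono-nonNegˡ 0≤p q≤1) (ℚ.≤-trans (ℚ.≤-reflexive (ℚ.*-identityʳ p)) p≤1)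

0≤1 : 0ℚ ≤ 1ℚ
0≤1 = ℚ.nonNegative⁻¹ 1ℚ

0≤½ : 0ℚ ≤ ½
0≤½ = ℚ.nonNegative⁻¹ ½

½≤1 : ½ ≤ 1ℚ
½≤1 = ℚ.≤ᵇ⇒≤ _

1-anti : ∀ {p q} → p ≤ q → 1ℚ - q ≤ 1ℚ - p
1-anti p≤q = ℚ.+-monoʳ-≤ 1ℚ (ℚ.neg-antimono-≤ p≤q)

half+half : ∀ p → ½ * (p + p) ≡ p
half+half = solve 1 (λ p → con ½ :* (p :+ p) := p) refl

-- Natural numbers as rationals, and powers of one half.

fromℕ : ℕ → ℚ
fromℕ zero    = 0ℚ
fromℕ (suc k) = 1ℚ + fromℕ k

fromℕ-nonNeg : ∀ k → 0ℚ ≤ fromℕ k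
fromℕ-nonNeg zero    = ℚ.≤-refl
fromℕ-nonNeg (suc k) = ℚ.+-mono-≤ 0≤1 (fromℕ-nonNeg k)

fromℕ-mono : ∀ {k l} → k ℕ.≤ l → fromℕ k ≤ fromℕ l
fromℕ-mono {l = l} ℕ.z≤n = fromℕ-nonNeg l
fromℕ-mono (ℕ.s≤s k≤l)   = ℚ.+-monoʳ-≤ 1ℚ (fromℕ-mono k≤l)

fromℕ-homo-+ : ∀ k l → fromℕ (k ℕ.+ l) ≡ fromℕ k + fromℕ l
fromℕ-homo-+ zero    l = sym (ℚ.+-identityˡ (fromℕ l))
fromℕ-homo-+ (suc k) l = trans (cong (1ℚ +_) (fromℕ-homo-+ k l)) (sym (ℚ.+-assoc 1ℚ (fromℕ k) (fromℕ l)))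

-- The recursion in `fromℕ` suits sums such as lengths of test sequences; this identification as a
-- fraction with denominator 1 is what allows a comparison with `a / b`.
toℚᵘ-fromℕ : ∀ k → toℚᵘ (fromℕ k) ℚᵘ.≃ mkℚᵘ (ℤ.+ k) 0
toℚᵘ-fromℕ zero    = ℚᵘ.≃-refl
toℚᵘ-fromℕ (suc k) = ℚᵘ.≃-trans (toℚᵘ-homo-+ 1ℚ (fromℕ k))
  (ℚᵘ.≃-trans (ℚᵘ.+-congʳ (toℚᵘ 1ℚ) (toℚᵘ-fromℕ k))
    (*≡* (cong (λ m → (ℤ.+ 1 ℤ.+ m) ℤ.* ℤ.+ 1) (ℤ.*-identityʳ (ℤ.+ k)))))

fromℕ≤/ : ∀ k a b .{{_ : NonZero b}} → k ℕ.* b ℕ.≤ a → fromℕ k ≤ ℤ.+ a / b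
fromℕ≤/ k a (suc b) kb≤a = toℚᵘ-cancel-≤
  (ℚᵘ.≤-respˡ-≃ (ℚᵘ.≃-sym (toℚᵘ-fromℕ k))
    (ℚᵘ.≤-respʳ-≃ (ℚᵘ.≃-sym (toℚᵘ-fromℚᵘ (mkℚᵘ (ℤ.+ a) b)))
      (*≤* (subst₂ ℤ._≤_ (ℤ.pos-* k (suc b)) (sym (ℤ.*-identityʳ (ℤ.+ a))) (ℤ.+≤+ kb≤a)))))

½^ : ℕ → ℚ
½^ zero    = 1ℚ
½^ (suc k) = ½ * ½^ k

½^-nonNeg : ∀ k → 0ℚ ≤ ½^ k
½^-nonNeg zero    = 0≤1
½^-nonNeg (suc k) = *-nonNeg 0≤½ (½^-nonNeg k)

½^≤1 : ∀ k → ½^ k ≤ 1ℚ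
½^≤1 zero    = ℚ.≤-refl
½^≤1 (suc k) = *-≤1 0≤½ ½≤1 (½^≤1 k)

½^-anti : ∀ {k l} → k ℕ.≤ l → ½^ l ≤ ½^ k
½^-anti {l = l} ℕ.z≤n = ½^≤1 l
½^-anti (ℕ.s≤s k≤l)   = *-mono-nonNegˡ 0≤½ (½^-anti k≤l)

0≤1-½^ : ∀ k → 0ℚ ≤ 1ℚ - ½^ k
0≤1-½^ k = 1-anti (½^≤1 k)

fromℕ-2^ : ∀ k → fromℕ (2 ℕ.^ k) * ½^ k ≡ 1ℚ
fromℕ-2^ zero    = refl
fromℕ-2^ (suc k) = begin
  fromℕ (2 ℕ.^ k ℕ.+ (2 ℕ.^ k ℕ.+ 0)) * (½ * ½^ k)
    ≡⟨ cong (λ m → fromℕ (2 ℕ.^ k ℕ.+ m) * (½ * ½^ k)) (ℕ.+-identityʳ (2 ℕ.^ k)) ⟩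
  fromℕ (2 ℕ.^ k ℕ.+ 2 ℕ.^ k) * (½ * ½^ k)
    ≡⟨ cong (_* (½ * ½^ k)) (fromℕ-homo-+ (2 ℕ.^ k) (2 ℕ.^ k)) ⟩
  (fromℕ (2 ℕ.^ k) + fromℕ (2 ℕ.^ k)) * (½ * ½^ k)
    ≡⟨ solve 2 (λ p h → (p :+ p) :* (con ½ :* h) := p :* h) refl (fromℕ (2 ℕ.^ k)) (½^ k) ⟩
  fromℕ (2 ℕ.^ k) * ½^ k
    ≡⟨ fromℕ-2^ k ⟩
  1ℚ ∎
  where open ≡-Reasoning

-- Comparison with the binary logarithm.

2^-bracket : ∀ n → 2 ℕ.≤ n → ∃ λ k → 2 ℕ.^ k ℕ.≤ n × n ℕ.≤ 2 ℕ.^ suc k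
2^-bracket (suc zero)          (ℕ.s≤s ())
2^-bracket (suc (suc zero))    _ = 0 , ℕ.s≤s ℕ.z≤n , ℕ.≤-refl
2^-bracket (suc (suc (suc m))) _ with 2^-bracket (suc (suc m)) (ℕ.s≤s (ℕ.s≤s ℕ.z≤n))
... | k , lower , upper with suc (suc (suc m)) ℕ.≤? 2 ℕ.^ suc k
...   | yes le = k , ℕ.m≤n⇒m≤1+n lower , le
-- Once the old upper bound fails, it becomes the new lower bound; the new upper bound holds because
-- `1` and the predecessor of the number are both at most `2 ^ suc k`.
...   | no ≰   = suc k , ℕ.<⇒≤ (ℕ.≰⇒> ≰) ,
  ℕ.≤-trans (ℕ.+-mono-≤ (ℕ.m^n>0 2 (suc k)) upper)
            (ℕ.≤-reflexive (cong (2 ℕ.^ suc k ℕ.+_) (sym (ℕ.+-identityʳ (2 ℕ.^ suc k)))))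

2^-cancel-≤ : ∀ {k l} → 2 ℕ.^ k ℕ.≤ 2 ℕ.^ l → k ℕ.≤ l
2^-cancel-≤ {k} {l} le with k ℕ.≤? l
... | yes k≤l = k≤l
... | no k≰l  = contradiction le (ℕ.<⇒≱ (ℕ.^-monoʳ-< 2 (ℕ.s≤s (ℕ.s≤s ℕ.z≤n)) (ℕ.≰⇒> k≰l)))

-- Every upper bound `q = a / b` of the logarithm is at least 1, because 2 ≤ n, and at least `k`,
-- because 2^k ≤ n. Hence k + 2 = 1 + 1 + k ≤ 3q, which is the origin of the constant 3.
fromℕ≤3·log₂ : ∀ {n} k → 2 ℕ.≤ n → 2 ℕ.^ k ℕ.≤ n → ∀ {z} → 0ℚ ≤ z →
               fromℕ (suc (suc k)) * z ≤ fromℕ 3 * z ·log₂ n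
fromℕ≤3·log₂ {n} k 2≤n 2^k≤n {z} 0≤z a b n^b≤2^a =
  ℚ.≤-trans (*-mono-nonNegʳ 0≤z k+2≤3q)
    (ℚ.≤-reflexive (solve 2 (λ q z → (q :+ (q :+ q)) :* z := con (fromℕ 3) :* z :* q) refl q z))
  where
  q = ℤ.+ a / b
  1≤q : 1ℚ ≤ q
  1≤q = fromℕ≤/ 1 a b (ℕ.≤-trans (ℕ.≤-reflexive (ℕ.*-identityˡ b))
          (2^-cancel-≤ (ℕ.≤-trans (ℕ.^-monoˡ-≤ b 2≤n) n^b≤2^a)))
  k≤q : fromℕ k ≤ q
  k≤q = fromℕ≤/ k a b (2^-cancel-≤ (ℕ.≤-trans (ℕ.≤-reflexive (sym (ℕ.^-*-assoc 2 k b)))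
          (ℕ.≤-trans (ℕ.^-monoˡ-≤ b 2^k≤n) n^b≤2^a)))
  k+2≤3q : fromℕ (suc (suc k)) ≤ q + (q + q)
  k+2≤3q = ℚ.+-mono-≤ 1≤q (ℚ.+-mono-≤ 1≤q k≤q)

-- Conditional expectation under the uniform distribution

𝔼[_∣_] : (Input n → ℚ) → Outcomes n → ℚ
𝔼[ g ∣ [] ]          = g []
𝔼[ g ∣ nothing ∷ ρ ] = ½ * (𝔼[ g ∘ (false ∷_) ∣ ρ ] + 𝔼[ g ∘ (true ∷_) ∣ ρ ])
𝔼[ g ∣ just b ∷ ρ ]  = 𝔼[ g ∘ (b ∷_) ∣ ρ ]

sumℚ : List ℚ → ℚ
sumℚ = foldr _+_ 0ℚ

sumℚ-++ : ∀ ps qs → sumℚ (ps ++ qs) ≡ sumℚ ps + sumℚ qs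
sumℚ-++ []       qs = sym (ℚ.+-identityˡ (sumℚ qs))
sumℚ-++ (p ∷ ps) qs = trans (cong (p +_) (sumℚ-++ ps qs)) (sym (ℚ.+-assoc p (sumℚ ps) (sumℚ qs)))

sumℚ-half : {A : Set} (u v : A → ℚ) (xs : List A) →
            sumℚ (List.map (λ x → (½ * u x) * v x) xs) ≡ ½ * sumℚ (List.map (λ x → u x * v x) xs)
sumℚ-half u v []       = sym (ℚ.*-zeroʳ ½)
sumℚ-half u v (x ∷ xs) = trans (cong (½ * u x * v x +_) (sumℚ-half u v xs))
  (solve 3 (λ p q r → con ½ :* p :* q :+ con ½ :* r := con ½ :* (p :* q :+ r)) refl (u x) (v x) _)

-- Links the weighted sum over all inputs to the recursive average: each half of the input list
-- carries a factor ½ from its first coordinate.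
𝔼≡𝔼[∣untested] : (g : Input n → ℚ) → 𝔼 (replicate n ½) g ≡ 𝔼[ g ∣ untested ]
𝔼≡𝔼[∣untested] {zero}  g = trans (ℚ.+-identityʳ (1ℚ * g [])) (ℚ.*-identityˡ (g []))
𝔼≡𝔼[∣untested] {suc n} g = begin
  sumℚ (List.map w (List.map (false ∷_) xs ++ List.map (true ∷_) xs))
    ≡⟨ cong sumℚ (List.map-++ w (List.map (false ∷_) xs) (List.map (true ∷_) xs)) ⟩
  sumℚ (List.map w (List.map (false ∷_) xs) ++ List.map w (List.map (true ∷_) xs))
    ≡⟨ sumℚ-++ (List.map w (List.map (false ∷_) xs)) _ ⟩
  sumℚ (List.map w (List.map (false ∷_) xs)) + sumℚ (List.map w (List.map (true ∷_) xs))
    ≡⟨ cong₂ (λ ps qs → sumℚ ps + sumℚ qs) (List.map-∘ xs) (List.map-∘ xs) ⟨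
  sumℚ (List.map (w ∘ (false ∷_)) xs) + sumℚ (List.map (w ∘ (true ∷_)) xs)
    ≡⟨ cong₂ _+_ (sumℚ-half (Pr (replicate n ½)) (g ∘ (false ∷_)) xs)
                 (sumℚ-half (Pr (replicate n ½)) (g ∘ (true ∷_)) xs) ⟩
  ½ * 𝔼 (replicate n ½) (g ∘ (false ∷_)) + ½ * 𝔼 (replicate n ½) (g ∘ (true ∷_))
    ≡⟨ ℚ.*-distribˡ-+ ½ (𝔼 (replicate n ½) (g ∘ (false ∷_))) (𝔼 (replicate n ½) (g ∘ (true ∷_))) ⟨
  ½ * (𝔼 (replicate n ½) (g ∘ (false ∷_)) + 𝔼 (replicate n ½) (g ∘ (true ∷_)))
    ≡⟨ cong₂ (λ p q → ½ * (p + q)) (𝔼≡𝔼[∣untested] (g ∘ (false ∷_))) (𝔼≡𝔼[∣untested] (g ∘ (true ∷_))) ⟩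
  𝔼[ g ∣ untested ] ∎
  where
  open ≡-Reasoning
  xs = inputs n
  w = λ x → Pr (replicate (suc n) ½) x * g x

𝔼-mono : {g h : Input n → ℚ} (ρ : Outcomes n) → (∀ x → x ⊒ ρ → g x ≤ h x) → 𝔼[ g ∣ ρ ] ≤ 𝔼[ h ∣ ρ ]
𝔼-mono []            g≤h = g≤h [] []
𝔼-mono (nothing ∷ ρ) g≤h = *-mono-nonNegˡ 0≤½
  (ℚ.+-mono-≤ (𝔼-mono ρ λ x x⊒ρ → g≤h (false ∷ x) (Maybe.nothing ∷ x⊒ρ))
              (𝔼-mono ρ λ x x⊒ρ → g≤h (true ∷ x) (Maybe.nothing ∷ x⊒ρ)))
𝔼-mono (just b ∷ ρ)  g≤h = 𝔼-mono ρ λ x x⊒ρ → g≤h (b ∷ x) (Maybe.just refl ∷ x⊒ρ)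

𝔼-cong : {g h : Input n → ℚ} (ρ : Outcomes n) → (∀ x → x ⊒ ρ → g x ≡ h x) → 𝔼[ g ∣ ρ ] ≡ 𝔼[ h ∣ ρ ]
𝔼-cong ρ g≡h = ℚ.≤-antisym (𝔼-mono ρ λ x x⊒ρ → ℚ.≤-reflexive (g≡h x x⊒ρ))
                            (𝔼-mono ρ λ x x⊒ρ → ℚ.≤-reflexive (sym (g≡h x x⊒ρ)))

𝔼-const : (p : ℚ) (ρ : Outcomes n) → 𝔼[ (λ _ → p) ∣ ρ ] ≡ p
𝔼-const p []            = refl
𝔼-const p (nothing ∷ ρ) = trans (cong (λ q → ½ * (q + q)) (𝔼-const p ρ)) (half+half p)
𝔼-const p (just _ ∷ ρ)  = 𝔼-const p ρ

𝔼-+ : (g h : Input n → ℚ) (ρ : Outcomes n) → 𝔼[ (λ x → g x + h x) ∣ ρ ] ≡ 𝔼[ g ∣ ρ ] + 𝔼[ h ∣ ρ ]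
𝔼-+ g h []            = refl
𝔼-+ g h (nothing ∷ ρ) = trans
  (cong₂ (λ p q → ½ * (p + q)) (𝔼-+ (g ∘ (false ∷_)) (h ∘ (false ∷_)) ρ) (𝔼-+ (g ∘ (true ∷_)) (h ∘ (true ∷_)) ρ))
  (solve 4 (λ p q r s → con ½ :* ((p :+ q) :+ (r :+ s)) := con ½ :* (p :+ r) :+ con ½ :* (q :+ s)) refl
    𝔼[ g ∘ (false ∷_) ∣ ρ ] 𝔼[ h ∘ (false ∷_) ∣ ρ ] 𝔼[ g ∘ (true ∷_) ∣ ρ ] 𝔼[ h ∘ (true ∷_) ∣ ρ ])
𝔼-+ g h (just b ∷ ρ)  = 𝔼-+ (g ∘ (b ∷_)) (h ∘ (b ∷_)) ρ

𝔼-* : (p : ℚ) (g : Input n → ℚ) (ρ : Outcomes n) → 𝔼[ (λ x → p * g x) ∣ ρ ] ≡ p * 𝔼[ g ∣ ρ ]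
𝔼-* p g []            = refl
𝔼-* p g (nothing ∷ ρ) = trans
  (cong₂ (λ q r → ½ * (q + r)) (𝔼-* p (g ∘ (false ∷_)) ρ) (𝔼-* p (g ∘ (true ∷_)) ρ))
  (solve 3 (λ p q r → con ½ :* (p :* q :+ p :* r) := p :* (con ½ :* (q :+ r))) refl
    p 𝔼[ g ∘ (false ∷_) ∣ ρ ] 𝔼[ g ∘ (true ∷_) ∣ ρ ])
𝔼-* p g (just b ∷ ρ)  = 𝔼-* p (g ∘ (b ∷_)) ρ

-- Law of total expectation for one test. The average is defined coordinate by coordinate from the
-- left, whereas a decision tree may test any untested variable.
𝔼-split : (g : Input n → ℚ) (ρ : Outcomes n) (i : Fin n) → lookup ρ i ≡ nothing →
          𝔼[ g ∣ ρ ] ≡ ½ * (𝔼[ g ∣ ρ [ i ]≔ just false ] + 𝔼[ g ∣ ρ [ i ]≔ just true ])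
𝔼-split g (nothing ∷ ρ) zero    eq = refl
𝔼-split g (nothing ∷ ρ) (suc i) eq = trans
  (cong₂ (λ p q → ½ * (p + q)) (𝔼-split (g ∘ (false ∷_)) ρ i eq) (𝔼-split (g ∘ (true ∷_)) ρ i eq))
  (solve 4 (λ p q r s → con ½ :* (con ½ :* (p :+ q) :+ con ½ :* (r :+ s))
                     := con ½ :* (con ½ :* (p :+ r) :+ con ½ :* (q :+ s))) refl
    𝔼[ g ∘ (false ∷_) ∣ ρ [ i ]≔ just false ] 𝔼[ g ∘ (false ∷_) ∣ ρ [ i ]≔ just true ]
    𝔼[ g ∘ (true ∷_) ∣ ρ [ i ]≔ just false ] 𝔼[ g ∘ (true ∷_) ∣ ρ [ i ]≔ just true ])
𝔼-split g (just b ∷ ρ)  (suc i) eq = 𝔼-split (g ∘ (b ∷_)) ρ i eq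

⊒-lookup : {x : Input n} {ρ : Outcomes n} (i : Fin n) {b : Bool} → x ⊒ ρ → lookup ρ i ≡ just b → lookup x i ≡ b
⊒-lookup zero    (Maybe.just eq ∷ _) refl = eq
⊒-lookup (suc i) (_ ∷ x⊒ρ)           eq   = ⊒-lookup i x⊒ρ eq

-- Terms as variable lists, and their state under partial outcomes.

Terms : ℕ → Set
Terms n = List (List (Fin n))

satisfied : Input n → List (Fin n) → Bool
satisfied x = all (lookup x)

Represents : Terms n → BoolFun n → Set
Represents Ts f = ∀ x → f x ≡ any (satisfied x) Ts

V : Terms n → ℚ
V []       = 0ℚ
V (T ∷ Ts) = 1ℚ + (1ℚ - ½^ (length T)) * V Ts

V-nonNeg : (Ts : Terms n) → 0ℚ ≤ V Ts
V-nonNeg []       = ℚ.≤-refl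
V-nonNeg (T ∷ Ts) = ℚ.+-mono-≤ 0≤1 (*-nonNeg (0≤1-½^ (length T)) (V-nonNeg Ts))

touched : Outcomes n → List (Fin n) → Bool
touched ρ = any (is-just ∘ lookup ρ)

value : Maybe Bool → ℚ
value nothing      = ½
value (just false) = 0ℚ
value (just true)  = 1ℚ

-- For a repetition-free list, the conditional probability given `ρ` that all its variables are 1;
-- the product expresses independence of the coordinates.
Pr[_∣_] : List (Fin n) → Outcomes n → ℚ
Pr[ [] ∣ ρ ]    = 1ℚ
Pr[ i ∷ T ∣ ρ ] = value (lookup ρ i) * Pr[ T ∣ ρ ]

value-nonNeg : ∀ m → 0ℚ ≤ value m
value-nonNeg nothing      = 0≤½
value-nonNeg (just false) = ℚ.≤-refl
value-nonNeg (just true)  = 0≤1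

value≤1 : ∀ m → value m ≤ 1ℚ
value≤1 nothing      = ½≤1
value≤1 (just false) = 0≤1
value≤1 (just true)  = ℚ.≤-refl

Pr-nonNeg : (T : List (Fin n)) (ρ : Outcomes n) → 0ℚ ≤ Pr[ T ∣ ρ ]
Pr-nonNeg []      ρ = 0≤1
Pr-nonNeg (i ∷ T) ρ = *-nonNeg (value-nonNeg (lookup ρ i)) (Pr-nonNeg T ρ)

Pr≤1 : (T : List (Fin n)) (ρ : Outcomes n) → Pr[ T ∣ ρ ] ≤ 1ℚ
Pr≤1 []      ρ = ℚ.≤-refl
Pr≤1 (i ∷ T) ρ = *-≤1 (value-nonNeg (lookup ρ i)) (value≤1 (lookup ρ i)) (Pr≤1 T ρ)

-- The probability called a in the outline. It is a product over the terms because disjoint terms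
-- are independent; an untouched term contributes 1.
alive : Outcomes n → Terms n → ℚ
alive ρ []       = 1ℚ
alive ρ (T ∷ Ts) = (if touched ρ T then 1ℚ - Pr[ T ∣ ρ ] else 1ℚ) * alive ρ Ts

untouchedTerms : Outcomes n → Terms n → Terms n
untouchedTerms ρ []       = []
untouchedTerms ρ (T ∷ Ts) = if touched ρ T then untouchedTerms ρ Ts else T ∷ untouchedTerms ρ Ts

module _ (ρ : Outcomes n) (T : List (Fin n)) (Ts : Terms n) where

  alive-touched : touched ρ T ≡ true → alive ρ (T ∷ Ts) ≡ (1ℚ - Pr[ T ∣ ρ ]) * alive ρ Ts
  alive-touched t rewrite t = refl

  alive-untouched : touched ρ T ≡ false → alive ρ (T ∷ Ts) ≡ alive ρ Ts
  alive-untouched t rewrite t = ℚ.*-identityˡ (alive ρ Ts)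

  untouchedTerms-touched : touched ρ T ≡ true → untouchedTerms ρ (T ∷ Ts) ≡ untouchedTerms ρ Ts
  untouchedTerms-touched t rewrite t = refl

  untouchedTerms-untouched : touched ρ T ≡ false → untouchedTerms ρ (T ∷ Ts) ≡ T ∷ untouchedTerms ρ Ts
  untouchedTerms-untouched t rewrite t = refl

factor-bounds : (ρ : Outcomes n) (T : List (Fin n)) →
                let q = if touched ρ T then 1ℚ - Pr[ T ∣ ρ ] else 1ℚ in 0ℚ ≤ q × q ≤ 1ℚ
factor-bounds ρ T with touched ρ T
... | true  = 1-anti (Pr≤1 T ρ) , 1-anti (Pr-nonNeg T ρ)
... | false = 0≤1 , ℚ.≤-refl

alive-bounds : (ρ : Outcomes n) (Ts : Terms n) → 0ℚ ≤ alive ρ Ts × alive ρ Ts ≤ 1ℚ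
alive-bounds ρ []       = 0≤1 , ℚ.≤-refl
alive-bounds ρ (T ∷ Ts) =
  let 0≤q , q≤1 = factor-bounds ρ T; 0≤a , a≤1 = alive-bounds ρ Ts
  in *-nonNeg 0≤q 0≤a , *-≤1 0≤q q≤1 a≤1

-- Effect of testing a variable

module _ (ρ : Outcomes n) (i : Fin n) (m : Maybe Bool) where

  touched-∉ : ∀ {T} → i ∉ T → touched (ρ [ i ]≔ m) T ≡ touched ρ T
  touched-∉ {[]}    i∉T = refl
  touched-∉ {j ∷ T} i∉T = cong₂ _∨_ (cong is-just (lookup∘update′ (i∉T ∘ here ∘ sym) ρ m)) (touched-∉ (i∉T ∘ there))

  Pr-∉ : ∀ {T} → i ∉ T → Pr[ T ∣ ρ [ i ]≔ m ] ≡ Pr[ T ∣ ρ ]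
  Pr-∉ {[]}    i∉T = refl
  Pr-∉ {j ∷ T} i∉T = cong₂ _*_ (cong value (lookup∘update′ (i∉T ∘ here ∘ sym) ρ m)) (Pr-∉ (i∉T ∘ there))

  alive-∉ : ∀ {Ts} → All (i ∉_) Ts → alive (ρ [ i ]≔ m) Ts ≡ alive ρ Ts
  alive-∉ []          = refl
  alive-∉ (i∉T ∷ i∉Ts) rewrite touched-∉ i∉T | Pr-∉ i∉T | alive-∉ i∉Ts = refl

  untouchedTerms-∉ : ∀ {Ts} → All (i ∉_) Ts → untouchedTerms (ρ [ i ]≔ m) Ts ≡ untouchedTerms ρ Ts
  untouchedTerms-∉ []          = refl
  untouchedTerms-∉ (i∉T ∷ i∉Ts) rewrite touched-∉ i∉T | untouchedTerms-∉ i∉Ts = refl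

touched-∈ : (ρ : Outcomes n) (i : Fin n) (b : Bool) {T : List (Fin n)} → i ∈ T → touched (ρ [ i ]≔ just b) T ≡ true
touched-∈ ρ i b (here refl) rewrite lookup∘update i ρ (just b) = refl
touched-∈ ρ i b {j ∷ T} (there i∈T) rewrite touched-∈ ρ i b i∈T = ∨-zeroʳ (is-just (lookup (ρ [ i ]≔ just b) j))

-- Only the factor of `i` reacts to the test: it is ½ before and 0 or 1 after, and ½ + ½ = 0 + 1.
-- Uniqueness ensures that this factor occurs once.
Pr-split : {ρ : Outcomes n} {i : Fin n} → lookup ρ i ≡ nothing → ∀ {T} → Unique T → i ∈ T →
           Pr[ T ∣ ρ [ i ]≔ just false ] + Pr[ T ∣ ρ [ i ]≔ just true ] ≡ Pr[ T ∣ ρ ] + Pr[ T ∣ ρ ]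
Pr-split {ρ = ρ} {i} eq {i ∷ T} u (here refl)
  rewrite lookup∘update i ρ (just false) | lookup∘update i ρ (just true) | eq
        | Pr-∉ ρ i (just false) (Unique[x∷xs]⇒x∉xs u) | Pr-∉ ρ i (just true) (Unique[x∷xs]⇒x∉xs u)
  = solve 1 (λ p → con 0ℚ :* p :+ con 1ℚ :* p := con ½ :* p :+ con ½ :* p) refl Pr[ T ∣ ρ ]
Pr-split {ρ = ρ} {i} eq {j ∷ T} u@(_ ∷ u′) (there i∈T)
  rewrite lookup∘update′ {i = j} {j = i} (λ {refl → Unique[x∷xs]⇒x∉xs u i∈T}) ρ (just false)
        | lookup∘update′ {i = j} {j = i} (λ {refl → Unique[x∷xs]⇒x∉xs u i∈T}) ρ (just true)
  = begin
    v * Pr[ T ∣ ρ [ i ]≔ just false ] + v * Pr[ T ∣ ρ [ i ]≔ just true ] ≡⟨ ℚ.*-distribˡ-+ v _ _ ⟨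
    v * (Pr[ T ∣ ρ [ i ]≔ just false ] + Pr[ T ∣ ρ [ i ]≔ just true ])   ≡⟨ cong (v *_) (Pr-split eq u′ i∈T) ⟩
    v * (Pr[ T ∣ ρ ] + Pr[ T ∣ ρ ])                                     ≡⟨ ℚ.*-distribˡ-+ v _ _ ⟩
    v * Pr[ T ∣ ρ ] + v * Pr[ T ∣ ρ ]                                   ∎
  where
  open ≡-Reasoning
  v = value (lookup ρ j)

Pr-untouched : (ρ : Outcomes n) (T : List (Fin n)) → touched ρ T ≡ false → Pr[ T ∣ ρ ] ≡ ½^ (length T)
Pr-untouched ρ []      eq = refl
Pr-untouched ρ (i ∷ T) eq with lookup ρ i
... | nothing = cong (½ *_) (Pr-untouched ρ T eq)

-- Testing i multiplies the mean of `alive` by q, the probability that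
-- the term started by the test (if any) fails.
record Step (ρ : Outcomes n) (i : Fin n) (Ts : Terms n) : Set where
  field
    q        : ℚ
    Us       : Terms n
    after    : ∀ b → untouchedTerms (ρ [ i ]≔ just b) Ts ≡ Us
    mean     : alive (ρ [ i ]≔ just false) Ts + alive (ρ [ i ]≔ just true) Ts ≡ q * (alive ρ Ts + alive ρ Ts)
    exchange : V (untouchedTerms ρ Ts) ≤ 1ℚ + q * V Us
    largest  : ∀ {k} → All (λ T → k ℕ.≤ length T) Ts → 1ℚ - ½^ k ≤ q

p≤1+1*p : ∀ p → p ≤ 1ℚ + 1ℚ * p
p≤1+1*p p = subst₂ _≤_ (ℚ.+-identityˡ p) (cong (1ℚ +_) (sym (ℚ.*-identityˡ p))) (ℚ.+-monoˡ-≤ p 0≤1)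

-- Induction along the sorted list until the term containing `i` is found; by disjointness the test
-- affects no other term. If no term contains `i`, the list runs out and `q` is 1. A term passed on
-- the way is kept in front by an exchange, for which `largest` is carried along.
step : (ρ : Outcomes n) (i : Fin n) → lookup ρ i ≡ nothing → (Ts : Terms n) →
       All Unique Ts → AllPairs Disjoint Ts → AllPairs (λ T T′ → length T ℕ.≤ length T′) Ts →
       Step ρ i Ts
step ρ i eq [] _ _ _ = record
  { q = 1ℚ ; Us = [] ; after = λ _ → refl ; mean = refl ; exchange = p≤1+1*p 0ℚ
  ; largest = λ {k} _ → 1-anti (½^-nonNeg k) }
step ρ i eq (T ∷ Ts) (u ∷ us) (d ∷ ds) (s ∷ ss) with DecMembership._∈?_ Fin._≟_ i T
... | yes i∈T = head
  where
  i∉Ts : All (i ∉_) Ts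
  i∉Ts = All.map (λ T#T′ i∈T′ → T#T′ (i∈T , i∈T′)) d
  a = alive ρ Ts
  p₀ = Pr[ T ∣ ρ [ i ]≔ just false ]
  p₁ = Pr[ T ∣ ρ [ i ]≔ just true ]
  p = Pr[ T ∣ ρ ]
  after-test : ∀ b → untouchedTerms (ρ [ i ]≔ just b) (T ∷ Ts) ≡ untouchedTerms ρ Ts
  after-test b = trans (untouchedTerms-touched (ρ [ i ]≔ just b) T Ts (touched-∈ ρ i b i∈T)) (untouchedTerms-∉ ρ i (just b) i∉Ts)
  alive-after : ∀ b → alive (ρ [ i ]≔ just b) (T ∷ Ts) ≡ (1ℚ - Pr[ T ∣ ρ [ i ]≔ just b ]) * a
  alive-after b = trans (alive-touched (ρ [ i ]≔ just b) T Ts (touched-∈ ρ i b i∈T))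
    (cong ((1ℚ - Pr[ T ∣ ρ [ i ]≔ just b ]) *_) (alive-∉ ρ i (just b) i∉Ts))
  mean-after : alive (ρ [ i ]≔ just false) (T ∷ Ts) + alive (ρ [ i ]≔ just true) (T ∷ Ts)
               ≡ ((1ℚ + 1ℚ) - (p + p)) * a
  mean-after = begin
    alive (ρ [ i ]≔ just false) (T ∷ Ts) + alive (ρ [ i ]≔ just true) (T ∷ Ts)
      ≡⟨ cong₂ _+_ (alive-after false) (alive-after true) ⟩
    (1ℚ - p₀) * a + (1ℚ - p₁) * a
      ≡⟨ solve 3 (λ p₀ p₁ a → (con 1ℚ :- p₀) :* a :+ (con 1ℚ :- p₁) :* a
                            := ((con 1ℚ :+ con 1ℚ) :- (p₀ :+ p₁)) :* a) refl p₀ p₁ a ⟩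
    ((1ℚ + 1ℚ) - (p₀ + p₁)) * a
      ≡⟨ cong (λ r → ((1ℚ + 1ℚ) - r) * a) (Pr-split eq u i∈T) ⟩
    ((1ℚ + 1ℚ) - (p + p)) * a ∎
    where open ≡-Reasoning
  head : Step ρ i (T ∷ Ts)
  head with touched ρ T in t
  -- `T` was touched before, so `alive` already contains the factor 1 - p and its mean does not
  -- change: `q` is 1.
  ... | true = record
    { q = 1ℚ ; Us = untouchedTerms ρ Ts ; after = after-test
    ; mean = trans mean-after (trans
        (solve 2 (λ p a → ((con 1ℚ :+ con 1ℚ) :- (p :+ p)) :* a
                       := con 1ℚ :* ((con 1ℚ :- p) :* a :+ (con 1ℚ :- p) :* a)) refl p a)
        (sym (cong (λ r → 1ℚ * (r + r)) (alive-touched ρ T Ts t))))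
    ; exchange = subst (λ Us → V Us ≤ 1ℚ + 1ℚ * V (untouchedTerms ρ Ts)) (sym (untouchedTerms-touched ρ T Ts t))
                   (p≤1+1*p (V (untouchedTerms ρ Ts)))
    ; largest = λ {k} _ → 1-anti (½^-nonNeg k) }
  -- The test starts `T`: its factor was 1 and becomes 1 - p on average, where p is `½^ (length T)`.
  -- `V` unfolds at its head, so `exchange` is an equality.
  ... | false = record
    { q = 1ℚ - ½^ (length T) ; Us = untouchedTerms ρ Ts ; after = after-test
    ; mean = trans mean-after (trans
        (solve 2 (λ p a → ((con 1ℚ :+ con 1ℚ) :- (p :+ p)) :* a := (con 1ℚ :- p) :* (a :+ a)) refl p a)
        (cong₂ (λ r s → (1ℚ - r) * (s + s)) (Pr-untouched ρ T t) (sym (alive-untouched ρ T Ts t))))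
    ; exchange = ℚ.≤-reflexive (cong V (untouchedTerms-untouched ρ T Ts t))
    ; largest = λ ks → 1-anti (½^-anti (All.head ks)) }
... | no i∉T = tail
  where
  open Step (step ρ i eq Ts us ds ss)
  c = if touched ρ T then 1ℚ - Pr[ T ∣ ρ ] else 1ℚ
  alive-after : ∀ b → alive (ρ [ i ]≔ just b) (T ∷ Ts) ≡ c * alive (ρ [ i ]≔ just b) Ts
  alive-after b rewrite touched-∉ ρ i (just b) i∉T | Pr-∉ ρ i (just b) i∉T = refl
  a = alive ρ Ts
  mean′ : alive (ρ [ i ]≔ just false) (T ∷ Ts) + alive (ρ [ i ]≔ just true) (T ∷ Ts)
          ≡ q * (c * a + c * a)
  mean′ = begin
    alive (ρ [ i ]≔ just false) (T ∷ Ts) + alive (ρ [ i ]≔ just true) (T ∷ Ts)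
      ≡⟨ cong₂ _+_ (alive-after false) (alive-after true) ⟩
    c * alive (ρ [ i ]≔ just false) Ts + c * alive (ρ [ i ]≔ just true) Ts
      ≡⟨ ℚ.*-distribˡ-+ c _ _ ⟨
    c * (alive (ρ [ i ]≔ just false) Ts + alive (ρ [ i ]≔ just true) Ts)
      ≡⟨ cong (c *_) mean ⟩
    c * (q * (a + a))
      ≡⟨ solve 3 (λ c q a → c :* (q :* (a :+ a)) := q :* (c :* a :+ c :* a)) refl c q a ⟩
    q * (c * a + c * a) ∎
    where open ≡-Reasoning
  tail : Step ρ i (T ∷ Ts)
  tail with touched ρ T in t
  ... | true = record
    { q = q ; Us = Us ; mean = mean′
    ; after = λ b → trans (untouchedTerms-touched (ρ [ i ]≔ just b) T Ts (trans (touched-∉ ρ i (just b) i∉T) t)) (after b)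
    ; exchange = subst (λ Us′ → V Us′ ≤ 1ℚ + q * V Us) (sym (untouchedTerms-touched ρ T Ts t)) exchange
    ; largest = λ ks → largest (All.tail ks) }
  ... | false = record
    { q = q ; Us = T ∷ Us ; mean = mean′
    ; after = λ b → trans (untouchedTerms-untouched (ρ [ i ]≔ just b) T Ts (trans (touched-∉ ρ i (just b) i∉T) t))
                          (cong (T ∷_) (after b))
    ; exchange = subst (λ Us′ → V Us′ ≤ 1ℚ + q * V (T ∷ Us)) (sym (untouchedTerms-untouched ρ T Ts t)) exchange′
    ; largest = λ ks → largest (All.tail ks) }
    where
    r = 1ℚ - ½^ (length T)
    -- With w = V Us, the inequality 1 + r(1 + qw) ≤ 1 + q(1 + rw) amounts to r ≤ q. `largest s`
    -- supplies this, since `T` is no longer than any term after it.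
    exchange′ : 1ℚ + r * V (untouchedTerms ρ Ts) ≤ 1ℚ + q * (1ℚ + r * V Us)
    exchange′ = ℚ.+-monoʳ-≤ 1ℚ (begin
      r * V (untouchedTerms ρ Ts) ≤⟨ *-mono-nonNegˡ (0≤1-½^ (length T)) exchange ⟩
      r * (1ℚ + q * V Us)         ≡⟨ solve 3 (λ r q w → r :* (con 1ℚ :+ q :* w) := r :+ q :* (r :* w)) refl r q (V Us) ⟩
      r + q * (r * V Us)          ≤⟨ ℚ.+-monoˡ-≤ _ (largest s) ⟩
      q + q * (r * V Us)          ≡⟨ solve 2 (λ q w → q :+ q :* w := q :* (con 1ℚ :+ w)) refl q (r * V Us) ⟩
      q * (1ℚ + r * V Us)         ∎)
      where open ℚ.≤-Reasoning

-- The potential as a lower bound for decision trees.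

potential : Outcomes n → Terms n → ℚ
potential ρ Ts = alive ρ Ts * V (untouchedTerms ρ Ts)

-- After `exchange`, the part of the potential that is lost is `alive ρ Ts`, a probability and hence
-- at most 1. The remaining part is exactly the average over the two outcomes.
potential-step : (ρ : Outcomes n) (i : Fin n) {Ts : Terms n} → Step ρ i Ts →
                 potential ρ Ts ≤ 1ℚ + ½ * (potential (ρ [ i ]≔ just false) Ts + potential (ρ [ i ]≔ just true) Ts)
potential-step ρ i {Ts} s = begin
  a * V (untouchedTerms ρ Ts)  ≤⟨ *-mono-nonNegˡ (proj₁ (alive-bounds ρ Ts)) exchange ⟩
  a * (1ℚ + q * w)             ≡⟨ solve 3 (λ a q w → a :* (con 1ℚ :+ q :* w) := a :+ con ½ :* (q :* (a :+ a) :* w)) refl a q w ⟩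
  a + ½ * (q * (a + a) * w)    ≤⟨ ℚ.+-monoˡ-≤ _ (proj₂ (alive-bounds ρ Ts)) ⟩
  1ℚ + ½ * (q * (a + a) * w)   ≡⟨ cong (λ r → 1ℚ + ½ * (r * w)) mean ⟨
  1ℚ + ½ * ((a₀ + a₁) * w)     ≡⟨ cong (λ r → 1ℚ + ½ * r) (ℚ.*-distribʳ-+ w a₀ a₁) ⟩
  1ℚ + ½ * (a₀ * w + a₁ * w)   ≡⟨ cong₂ (λ u v → 1ℚ + ½ * (a₀ * V u + a₁ * V v)) (after false) (after true) ⟨
  1ℚ + ½ * (potential (ρ [ i ]≔ just false) Ts + potential (ρ [ i ]≔ just true) Ts) ∎
  where
  open Step s
  open ℚ.≤-Reasoning
  a = alive ρ Ts
  a₀ = alive (ρ [ i ]≔ just false) Ts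
  a₁ = alive (ρ [ i ]≔ just true) Ts
  w = V Us

-- Represented functions are monotone, so the completions by false and by true are the extreme
-- inputs consistent with `ρ`; they suffice to exploit determinedness.
completion : Bool → Outcomes n → Input n
completion b = Vec.map (fromMaybe b)

completion-⊒ : (b : Bool) (ρ : Outcomes n) → completion b ρ ⊒ ρ
completion-⊒ b []            = []
completion-⊒ b (nothing ∷ ρ) = Maybe.nothing ∷ completion-⊒ b ρ
completion-⊒ b (just _ ∷ ρ)  = Maybe.just refl ∷ completion-⊒ b ρ

satisfied⇒Pr≡1 : (ρ : Outcomes n) (T : List (Fin n)) → satisfied (completion false ρ) T ≡ true → Pr[ T ∣ ρ ] ≡ 1ℚ
satisfied⇒Pr≡1 ρ []      eq = refl
satisfied⇒Pr≡1 ρ (i ∷ T) eq rewrite lookup-map i (fromMaybe false) ρ with lookup ρ i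
... | just true = cong (1ℚ *_) (satisfied⇒Pr≡1 ρ T eq)

satisfied⇒touched : (ρ : Outcomes n) (T : List (Fin n)) → T ≢ [] → satisfied (completion false ρ) T ≡ true → touched ρ T ≡ true
satisfied⇒touched ρ []      T≢[] eq = contradiction refl T≢[]
satisfied⇒touched ρ (i ∷ T) T≢[] eq rewrite lookup-map i (fromMaybe false) ρ with lookup ρ i
... | just true = refl

-- A term satisfied even when all untested variables are 0 has been tested completely with outcomes
-- 1. Being nonempty it is touched, and its factor 1 - 1 annihilates the product.
alive-satisfied : (ρ : Outcomes n) {Ts : Terms n} → All (_≢ []) Ts →
                  any (satisfied (completion false ρ)) Ts ≡ true → alive ρ Ts ≡ 0ℚ
alive-satisfied ρ {T ∷ Ts} (T≢[] ∷ ne) eq with satisfied (completion false ρ) T in s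
... | true  = trans (alive-touched ρ T Ts (satisfied⇒touched ρ T T≢[] s))
  (trans (cong (λ r → (1ℚ - r) * alive ρ Ts) (satisfied⇒Pr≡1 ρ T s)) (ℚ.*-zeroˡ (alive ρ Ts)))
... | false = trans (cong ((if touched ρ T then 1ℚ - Pr[ T ∣ ρ ] else 1ℚ) *_) (alive-satisfied ρ ne eq))
  (ℚ.*-zeroʳ (if touched ρ T then 1ℚ - Pr[ T ∣ ρ ] else 1ℚ))

falsified⇒touched : (ρ : Outcomes n) (T : List (Fin n)) → satisfied (completion true ρ) T ≡ false → touched ρ T ≡ true
falsified⇒touched ρ (i ∷ T) eq rewrite lookup-map i (fromMaybe true) ρ with lookup ρ i
... | nothing    = falsified⇒touched ρ T eq
... | just _     = refl

-- An untouched term would be satisfied by the completion with all untested variables 1.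
untouchedTerms-falsified : (ρ : Outcomes n) (Ts : Terms n) →
                           any (satisfied (completion true ρ)) Ts ≡ false → untouchedTerms ρ Ts ≡ []
untouchedTerms-falsified ρ []       eq = refl
untouchedTerms-falsified ρ (T ∷ Ts) eq with satisfied (completion true ρ) T in s
... | false = trans (untouchedTerms-touched ρ T Ts (falsified⇒touched ρ T s)) (untouchedTerms-falsified ρ Ts eq)

-- The two completions give `f` the same value. If it is true, some term is certainly satisfied and
-- `alive` vanishes; if it is false, no untouched term remains and `V` vanishes.
potential-determined : {f : BoolFun n} {Ts : Terms n} → Represents Ts f → All (_≢ []) Ts →
                       (ρ : Outcomes n) → Determined f ρ → potential ρ Ts ≡ 0ℚ
potential-determined {f = f} {Ts} rep ne ρ det
  with any (satisfied (completion false ρ)) Ts in s₀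
... | true = trans (cong (_* V (untouchedTerms ρ Ts)) (alive-satisfied ρ ne s₀)) (ℚ.*-zeroˡ (V (untouchedTerms ρ Ts)))
... | false = trans (cong (λ Us → alive ρ Ts * V Us) (untouchedTerms-falsified ρ Ts s₁)) (ℚ.*-zeroʳ (alive ρ Ts))
  where
  s₁ : any (satisfied (completion true ρ)) Ts ≡ false
  s₁ = trans (sym (rep (completion true ρ)))
    (trans (det _ _ (completion-⊒ true ρ) (completion-⊒ false ρ)) (trans (rep (completion false ρ)) s₀))

touched-untested : (T : List (Fin n)) → touched untested T ≡ false
touched-untested []      = refl
touched-untested {n} (i ∷ T) rewrite lookup-replicate {n = n} i (nothing {A = Bool}) = touched-untested T

potential-untested : (Ts : Terms n) → potential untested Ts ≡ V Ts
potential-untested Ts = trans (cong₂ _*_ (a Ts) (cong V (u Ts))) (ℚ.*-identityˡ (V Ts))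
  where
  a : ∀ Ts → alive untested Ts ≡ 1ℚ
  a []       = refl
  a (T ∷ Ts) = trans (alive-untouched untested T Ts (touched-untested T)) (a Ts)
  u : ∀ Ts → untouchedTerms untested Ts ≡ Ts
  u []       = refl
  u (T ∷ Ts) = trans (untouchedTerms-untouched untested T Ts (touched-untested T)) (cong (T ∷_) (u Ts))

module _ {f : BoolFun n} {Ts : Terms n} (rep : Represents Ts f) (ne : All (_≢ []) Ts)
         (us : All Unique Ts) (ds : AllPairs Disjoint Ts)
         (ss : AllPairs (λ T T′ → length T ℕ.≤ length T′) Ts) where

  unitCost : {ρ : Outcomes n} → Tree f ρ → Input n → ℚ
  unitCost t x = treeCost (replicate n 1ℚ) x t

  𝔼-branch : {ρ : Outcomes n} (i : Fin n) (b : Bool) {t₀ : Tree f (ρ [ i ]≔ just false)} {t₁ : Tree f (ρ [ i ]≔ just true)} →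
             𝔼[ (λ x → lookup (replicate n 1ℚ) i + (if lookup x i then unitCost t₁ x else unitCost t₀ x)) ∣ ρ [ i ]≔ just b ]
             ≡ 1ℚ + 𝔼[ (λ x → if b then unitCost t₁ x else unitCost t₀ x) ∣ ρ [ i ]≔ just b ]
  𝔼-branch {ρ} i b {t₀} {t₁} = trans (𝔼-+ (λ _ → lookup (replicate n 1ℚ) i) _ (ρ [ i ]≔ just b)) (cong₂ _+_
    (trans (𝔼-const (lookup (replicate n 1ℚ) i) (ρ [ i ]≔ just b)) (lookup-replicate i 1ℚ))
    (𝔼-cong (ρ [ i ]≔ just b) λ x x⊒ →
      cong (λ c → if c then unitCost t₁ x else unitCost t₀ x) (⊒-lookup i x⊒ (lookup∘update i ρ (just b)))))

  -- Induction on the tree: the potential is 0 at a leaf, and at a test its average drop is at most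
  -- the unit cost paid.
  potential≤𝔼 : {ρ : Outcomes n} (t : Tree f ρ) → potential ρ Ts ≤ 𝔼[ unitCost t ∣ ρ ]
  -- The tree stores its side conditions irrelevantly; decidability recovers usable proofs, here and
  -- for `eq′` below.
  potential≤𝔼 {ρ} (stop det) = ℚ.≤-reflexive
    (trans (potential-determined rep ne ρ (recompute (determined? f ρ) det)) (sym (𝔼-const 0ℚ ρ)))
  potential≤𝔼 {ρ} (test i eq ¬det t₀ t₁) = begin
    potential ρ Ts
      ≤⟨ potential-step ρ i (step ρ i eq′ Ts us ds ss) ⟩
    1ℚ + ½ * (potential ρ₀ Ts + potential ρ₁ Ts)
      ≤⟨ ℚ.+-monoʳ-≤ 1ℚ (*-mono-nonNegˡ 0≤½ (ℚ.+-mono-≤ (potential≤𝔼 t₀) (potential≤𝔼 t₁))) ⟩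
    1ℚ + ½ * (e₀ + e₁)
      ≡⟨ solve 2 (λ e₀ e₁ → con 1ℚ :+ con ½ :* (e₀ :+ e₁) := con ½ :* ((con 1ℚ :+ e₀) :+ (con 1ℚ :+ e₁))) refl e₀ e₁ ⟩
    ½ * ((1ℚ + e₀) + (1ℚ + e₁))
      ≡⟨ cong₂ (λ p q → ½ * (p + q)) (𝔼-branch i false {t₀} {t₁}) (𝔼-branch i true {t₀} {t₁}) ⟨
    ½ * (𝔼[ unitCost t ∣ ρ₀ ] + 𝔼[ unitCost t ∣ ρ₁ ])
      ≡⟨ 𝔼-split (unitCost t) ρ i eq′ ⟨
    𝔼[ unitCost t ∣ ρ ] ∎
    where
    open ℚ.≤-Reasoning
    t : Tree f ρ
    t = test i eq ¬det t₀ t₁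
    eq′ = recompute (Maybe.≡-dec Bool._≟_ (lookup ρ i) nothing) eq
    ρ₀ = ρ [ i ]≔ just false
    ρ₁ = ρ [ i ]≔ just true
    e₀ = 𝔼[ unitCost t₀ ∣ ρ₀ ]
    e₁ = 𝔼[ unitCost t₁ ∣ ρ₁ ]

  V≤OPT : V Ts ≤ OPT𝒜 f (replicate n 1ℚ) (replicate n ½)
  V≤OPT = begin
    V Ts                                             ≡⟨ potential-untested Ts ⟨
    potential untested Ts                            ≤⟨ potential≤𝔼 t ⟩
    𝔼[ unitCost t ∣ untested ]                       ≡⟨ 𝔼≡𝔼[∣untested] (unitCost t) ⟨
    cost𝒜 f (replicate n 1ℚ) (replicate n ½) t       ∎
    where
    open ℚ.≤-Reasoning
    t = optimal f (replicate n 1ℚ) (replicate n ½)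

-- Independence of disjoint sets of variables.

indicator : Bool → ℚ
indicator b = if b then 1ℚ else 0ℚ

IndependentOf : {A : Set} → Fin n → (Input n → A) → Set
IndependentOf i h = ∀ x b → h (x [ i ]≔ b) ≡ h x

𝔼-bit : (i : Fin n) (h : Input n → ℚ) → IndependentOf i h →
        𝔼[ (λ x → indicator (lookup x i) * h x) ∣ untested ] ≡ ½ * 𝔼[ h ∣ untested ]
𝔼-bit {suc n} zero h ind = begin
  ½ * (𝔼[ (λ x → 0ℚ * h (false ∷ x)) ∣ untested ] + 𝔼[ (λ x → 1ℚ * h (true ∷ x)) ∣ untested ])
    ≡⟨ cong₂ (λ p q → ½ * (p + q)) (𝔼-* 0ℚ (h ∘ (false ∷_)) untested) (𝔼-* 1ℚ (h ∘ (true ∷_)) untested) ⟩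
  ½ * (0ℚ * e₀ + 1ℚ * e₁)
    ≡⟨ cong (½ *_) (solve 2 (λ e₀ e₁ → con 0ℚ :* e₀ :+ con 1ℚ :* e₁ := con ½ :* (e₁ :+ e₁)) refl e₀ e₁) ⟩
  ½ * (½ * (e₁ + e₁))
    -- By independence of coordinate `zero`, `e₀` and `e₁` agree, so one copy of `e₁` may be
    -- replaced.
    ≡⟨ cong (λ e → ½ * (½ * (e + e₁))) (𝔼-cong untested λ x _ → ind (false ∷ x) true) ⟩
  ½ * (½ * (e₀ + e₁)) ∎
  where
  open ≡-Reasoning
  e₀ = 𝔼[ h ∘ (false ∷_) ∣ untested ]
  e₁ = 𝔼[ h ∘ (true ∷_) ∣ untested ]
𝔼-bit {suc n} (suc i) h ind = begin
  ½ * (𝔼[ (λ x → indicator (lookup x i) * h (false ∷ x)) ∣ untested ] + 𝔼[ (λ x → indicator (lookup x i) * h (true ∷ x)) ∣ untested ])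
    ≡⟨ cong₂ (λ p q → ½ * (p + q)) (𝔼-bit i (h ∘ (false ∷_)) λ x → ind (false ∷ x)) (𝔼-bit i (h ∘ (true ∷_)) λ x → ind (true ∷ x)) ⟩
  ½ * (½ * e₀ + ½ * e₁)
    ≡⟨ cong (½ *_) (ℚ.*-distribˡ-+ ½ e₀ e₁) ⟨
  ½ * (½ * (e₀ + e₁)) ∎
  where
  open ≡-Reasoning
  e₀ = 𝔼[ h ∘ (false ∷_) ∣ untested ]
  e₁ = 𝔼[ h ∘ (true ∷_) ∣ untested ]

satisfied-independent : {i : Fin n} {T : List (Fin n)} → i ∉ T → IndependentOf i (λ x → satisfied x T)
satisfied-independent {T = []}    i∉T x b = refl
satisfied-independent {T = j ∷ T} i∉T x b =
  cong₂ _∧_ (lookup∘update′ (i∉T ∘ here ∘ sym) x b) (satisfied-independent (i∉T ∘ there) x b)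

indicator-∧ : ∀ a b → indicator (a ∧ b) ≡ indicator a * indicator b
indicator-∧ true  b = sym (ℚ.*-identityˡ (indicator b))
indicator-∧ false b = sym (ℚ.*-zeroˡ (indicator b))

-- The bits of `T` are split off one at a time, each giving a factor ½. Uniqueness keeps the
-- indicator of the remaining bits independent of the current one.
𝔼-satisfied : {T : List (Fin n)} → Unique T → (h : Input n → ℚ) → (∀ {i} → i ∈ T → IndependentOf i h) →
              𝔼[ (λ x → indicator (satisfied x T) * h x) ∣ untested ] ≡ ½^ (length T) * 𝔼[ h ∣ untested ]
𝔼-satisfied {T = []}    []       h ind = 𝔼-* 1ℚ h untested
𝔼-satisfied {T = i ∷ T} u@(_ ∷ u′) h ind = begin
  𝔼[ (λ x → indicator (lookup x i ∧ satisfied x T) * h x) ∣ untested ]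
    ≡⟨ 𝔼-cong untested (λ x _ → trans (cong (_* h x) (indicator-∧ (lookup x i) (satisfied x T)))
                                       (ℚ.*-assoc (indicator (lookup x i)) (indicator (satisfied x T)) (h x))) ⟩
  𝔼[ (λ x → indicator (lookup x i) * (indicator (satisfied x T) * h x)) ∣ untested ]
    ≡⟨ 𝔼-bit i (λ x → indicator (satisfied x T) * h x) (λ x b → cong₂ (λ s p → indicator s * p)
         (satisfied-independent (Unique[x∷xs]⇒x∉xs u) x b) (ind (here refl) x b)) ⟩
  ½ * 𝔼[ (λ x → indicator (satisfied x T) * h x) ∣ untested ]
    ≡⟨ cong (½ *_) (𝔼-satisfied u′ h (ind ∘ there)) ⟩
  ½ * (½^ (length T) * 𝔼[ h ∣ untested ])
    ≡⟨ ℚ.*-assoc ½ (½^ (length T)) 𝔼[ h ∣ untested ] ⟨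
  ½ * ½^ (length T) * 𝔼[ h ∣ untested ] ∎
  where open ≡-Reasoning

-- Upper bound for the expected cost of testing truncated terms.

take-⊆ : ∀ {A : Set} k {xs : List A} {y} → y ∈ take k xs → y ∈ xs
take-⊆ k {xs} y∈ = subst (_ ∈_) (List.take++drop≡id k xs) (∈-++⁺ˡ y∈)

-- Case analysis on a decision buried in a definition such as `runCost` or `penalty`, with the goal
-- passed as the predicate `Q`.
if-dec : {P : Set} (P? : Dec P) (Q : ℚ → Set) {p q : ℚ} → (P → Q p) → (¬ P → Q q) → Q (if does P? then p else q)
if-dec (yes a) Q Qp Qq = Qp a
if-dec (no ¬a) Q Qp Qq = Qq ¬a

-- The tests made once the first L variables of T are all 1: none if these
-- are all of T, possibly every variable otherwise.
penalty : ℕ → List (Fin n) → ℚ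
penalty {n} L T = if does (length T ℕ.≤? L) then 0ℚ else fromℕ n

-- Charges `L` for each term looked at, even a shorter one, and `penalty` at the first term whose
-- first `L` variables are all 1.
costBound : ℕ → Terms n → Input n → ℚ
costBound L []       x = 0ℚ
costBound L (T ∷ Ts) x = fromℕ L + (if satisfied x (take L T) then penalty L T else costBound L Ts x)

costBound-independent : ∀ L {i : Fin n} {Ts : Terms n} → All (i ∉_) Ts → IndependentOf i (costBound L Ts)
costBound-independent L []                        x b = refl
costBound-independent L {Ts = T ∷ Ts} (i∉T ∷ i∉Ts) x b =
  cong₂ (λ s p → fromℕ L + (if s then penalty L T else p))
    (satisfied-independent (i∉T ∘ take-⊆ L) x b) (costBound-independent L i∉Ts x b)

-- A penalty arises only for a term longer than `L`. Its tested part then has exactly `L` variables,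
-- so the expected penalty is n / 2^L. This fixes how large `L` must be.
penalty-½^ : ∀ L → n ℕ.≤ 2 ℕ.^ L → (T : List (Fin n)) → ½^ (length (take L T)) * penalty L T ≤ 1ℚ
penalty-½^ {n} L n≤2^L T = if-dec (length T ℕ.≤? L) (λ p → ½^ (length (take L T)) * p ≤ 1ℚ)
  (λ _ → ℚ.≤-trans (ℚ.≤-reflexive (ℚ.*-zeroʳ (½^ (length (take L T))))) 0≤1)
  (λ T≰L → begin
    ½^ (length (take L T)) * fromℕ n ≡⟨ cong (λ k → ½^ k * fromℕ n) (trans (List.length-take L T) (ℕ.m≤n⇒m⊓n≡m (ℕ.<⇒≤ (ℕ.≰⇒> T≰L)))) ⟩
    ½^ L * fromℕ n                   ≤⟨ *-mono-nonNegˡ (½^-nonNeg L) (fromℕ-mono n≤2^L) ⟩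
    ½^ L * fromℕ (2 ℕ.^ L)           ≡⟨ ℚ.*-comm (½^ L) (fromℕ (2 ℕ.^ L)) ⟩
    fromℕ (2 ℕ.^ L) * ½^ L           ≡⟨ fromℕ-2^ L ⟩
    1ℚ                               ∎)
  where open ℚ.≤-Reasoning

-- Makes the conditional linear, so that `𝔼-+`, `𝔼-*` and `𝔼-satisfied` apply; the difference is
-- written with the scalar -1 to fit `𝔼-*`.
if-indicator : ∀ b p q → (if b then p else q) ≡ q + indicator b * (p + - 1ℚ * q)
if-indicator true  = solve 2 (λ p q → p := q :+ con 1ℚ :* (p :+ con (- 1ℚ) :* q)) refl
if-indicator false = solve 2 (λ p q → q := q :+ con 0ℚ :* (p :+ con (- 1ℚ) :* q)) refl

-- The expected bound obeys the recurrence of `V`, scaled by L + 1: at most `L` tests per term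
-- looked at, plus an expected penalty of at most 1.
𝔼-costBound : ∀ L → n ℕ.≤ 2 ℕ.^ L → {Ts : Terms n} → All Unique Ts → AllPairs Disjoint Ts →
              𝔼[ costBound L Ts ∣ untested ] ≤ fromℕ (suc L) * V Ts
𝔼-costBound {n} L n≤2^L {[]} _ _ = ℚ.≤-reflexive (trans (𝔼-const 0ℚ (untested {n})) (sym (ℚ.*-zeroʳ (fromℕ (suc L)))))
𝔼-costBound {n} L n≤2^L {T ∷ Ts} (u ∷ us) (d ∷ ds) = begin
  𝔼[ (λ x → l + (if satisfied x (take L T) then p else costBound L Ts x)) ∣ untested ]
    ≡⟨ 𝔼-+ (λ _ → l) (λ x → if satisfied x (take L T) then p else costBound L Ts x) (untested {n}) ⟩
  𝔼[ (λ _ → l) ∣ untested {n} ] + 𝔼[ (λ x → if satisfied x (take L T) then p else costBound L Ts x) ∣ untested ]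
    ≡⟨ cong₂ _+_ (𝔼-const l (untested {n})) (𝔼-cong untested λ x _ → if-indicator (satisfied x (take L T)) p (costBound L Ts x)) ⟩
  l + 𝔼[ (λ x → costBound L Ts x + indicator (satisfied x (take L T)) * h x) ∣ untested ]
    ≡⟨ cong (l +_) (𝔼-+ (costBound L Ts) (λ x → indicator (satisfied x (take L T)) * h x) untested) ⟩
  l + (e + 𝔼[ (λ x → indicator (satisfied x (take L T)) * h x) ∣ untested ])
    ≡⟨ cong (λ z → l + (e + z)) (𝔼-satisfied (Unique.take⁺ L u) h λ i∈ x b →
         cong (λ z → p + - 1ℚ * z) (costBound-independent L (i∉Ts (take-⊆ L i∈)) x b)) ⟩
  l + (e + w * 𝔼[ h ∣ untested ])
    ≡⟨ cong (λ z → l + (e + w * z)) (trans (𝔼-+ (λ _ → p) (λ x → - 1ℚ * costBound L Ts x) (untested {n}))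
         (cong₂ _+_ (𝔼-const p (untested {n})) (𝔼-* (- 1ℚ) (costBound L Ts) untested))) ⟩
  l + (e + w * (p + - 1ℚ * e))
    ≡⟨ solve 4 (λ l e w p → l :+ (e :+ w :* (p :+ con (- 1ℚ) :* e)) := (w :* p :+ l) :+ (con 1ℚ :- w) :* e) refl l e w p ⟩
  (w * p + l) + (1ℚ - w) * e
    ≤⟨ ℚ.+-mono-≤ (ℚ.+-monoˡ-≤ l (penalty-½^ L n≤2^L T)) (*-mono-nonNegˡ (0≤1-½^ (length (take L T))) (𝔼-costBound L n≤2^L us ds)) ⟩
  (1ℚ + l) + (1ℚ - w) * ((1ℚ + l) * V Ts)
    -- A truncated term is at least as likely to be satisfied as the full one, so the search goes on
    -- with at most the probability used in `V`.
    ≤⟨ ℚ.+-monoʳ-≤ (1ℚ + l) (*-mono-nonNegʳ (*-nonNeg (fromℕ-nonNeg (suc L)) (V-nonNeg Ts)) (1-anti (½^-anti take≤))) ⟩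
  (1ℚ + l) + (1ℚ - ½^ (length T)) * ((1ℚ + l) * V Ts)
    ≡⟨ solve 3 (λ m r v → m :+ r :* (m :* v) := m :* (con 1ℚ :+ r :* v)) refl (1ℚ + l) (1ℚ - ½^ (length T)) (V Ts) ⟩
  (1ℚ + l) * V (T ∷ Ts) ∎
  where
  open ℚ.≤-Reasoning
  l = fromℕ L
  p = penalty L T
  w = ½^ (length (take L T))
  e = 𝔼[ costBound L Ts ∣ untested ]
  h = λ x → p + - 1ℚ * costBound L Ts x
  i∉Ts : ∀ {i} → i ∈ T → All (i ∉_) Ts
  i∉Ts i∈T = All.map (λ T#T′ i∈T′ → T#T′ (i∈T , i∈T′)) d
  take≤ : length (take L T) ℕ.≤ length T
  take≤ = ℕ.≤-trans (ℕ.≤-reflexive (List.length-take L T)) (ℕ.m⊓n≤n L (length T))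

penalty-nonNeg : ∀ L (T : List (Fin n)) → 0ℚ ≤ penalty L T
penalty-nonNeg {n} L T = if-dec (length T ℕ.≤? L) (0ℚ ≤_) (λ _ → ℚ.≤-refl) (λ _ → fromℕ-nonNeg n)

costBound-nonNeg : ∀ L (Ts : Terms n) x → 0ℚ ≤ costBound L Ts x
costBound-nonNeg L []       x = ℚ.≤-refl
costBound-nonNeg L (T ∷ Ts) x with satisfied x (take L T)
... | true  = ℚ.+-mono-≤ (fromℕ-nonNeg L) (penalty-nonNeg L T)
... | false = ℚ.+-mono-≤ (fromℕ-nonNeg L) (costBound-nonNeg L Ts x)

-- Running a list of tests

observe : Input n → Outcomes n → List (Fin n) → Outcomes n
observe x ρ []       = ρ
observe x ρ (i ∷ is) = observe x (ρ [ i ]≔ just (lookup x i)) is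

⊒-test : {x : Input n} {ρ : Outcomes n} (i : Fin n) → x ⊒ ρ → x ⊒ ρ [ i ]≔ just (lookup x i)
⊒-test zero    (_ ∷ x⊒ρ) = Maybe.just refl ∷ x⊒ρ
⊒-test (suc i) (m ∷ x⊒ρ) = m ∷ ⊒-test i x⊒ρ

-- If `i` was tested before, the overwritten outcome equals the new one because `x` is consistent
-- with `ρ`; so nothing known is lost.
⊒-untest : {x x′ : Input n} {ρ : Outcomes n} (i : Fin n) → x ⊒ ρ → x′ ⊒ ρ [ i ]≔ just (lookup x i) → x′ ⊒ ρ
⊒-untest zero    (Maybe.just refl ∷ _) (m ∷ x′⊒ρ)            = m ∷ x′⊒ρ
⊒-untest zero    (Maybe.nothing ∷ _)   (_ ∷ x′⊒ρ)            = Maybe.nothing ∷ x′⊒ρ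
⊒-untest (suc i) (_ ∷ x⊒ρ)             (m ∷ x′⊒ρ)            = m ∷ ⊒-untest i x⊒ρ x′⊒ρ

observe-⊒ : {x : Input n} {ρ : Outcomes n} (is : List (Fin n)) → x ⊒ ρ → x ⊒ observe x ρ is
observe-⊒ []       x⊒ρ = x⊒ρ
observe-⊒ (i ∷ is) x⊒ρ = observe-⊒ is (⊒-test i x⊒ρ)

⊒-unobserve : {x x′ : Input n} {ρ : Outcomes n} (is : List (Fin n)) → x ⊒ ρ → x′ ⊒ observe x ρ is → x′ ⊒ ρ
⊒-unobserve []       x⊒ρ x′⊒ρ = x′⊒ρ
⊒-unobserve (i ∷ is) x⊒ρ x′⊒ρ = ⊒-untest i x⊒ρ (⊒-unobserve is (⊒-test i x⊒ρ) x′⊒ρ)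

observe-satisfied : {x x′ : Input n} {ρ : Outcomes n} (is : List (Fin n)) → x ⊒ ρ → x′ ⊒ observe x ρ is →
                    satisfied x′ is ≡ satisfied x is
observe-satisfied []       x⊒ρ x′⊒ρ = refl
observe-satisfied {x = x} {ρ = ρ} (i ∷ is) x⊒ρ x′⊒ρ = cong₂ _∧_
  (⊒-lookup i (⊒-unobserve is (⊒-test i x⊒ρ) x′⊒ρ) (lookup∘update i ρ (just (lookup x i))))
  (observe-satisfied is (⊒-test i x⊒ρ) x′⊒ρ)

satisfied-take : ∀ L (x : Input n) T → satisfied x (take L T) ≡ false → satisfied x T ≡ false
satisfied-take (suc L) x (i ∷ T) eq with lookup x i
... | true  = satisfied-take L x T eq
... | false = refl

untested-⊒ : (x : Input n) → x ⊒ untested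
untested-⊒ []      = []
untested-⊒ (b ∷ x) = Maybe.nothing ∷ untested-⊒ x

module _ (f : BoolFun n) (x : Input n) where

  run : Outcomes n → List (Fin n) → ℚ
  run = runCost f (replicate n 1ℚ) x

  1+-lookup : ∀ i {p q} → p ≤ q → lookup (replicate n 1ℚ) i + p ≤ 1ℚ + q
  1+-lookup i p≤q = ℚ.+-mono-≤ (ℚ.≤-reflexive (lookup-replicate i 1ℚ)) p≤q

  run≤length : ∀ ρ is → run ρ is ≤ fromℕ (length is)
  run≤length ρ []       = ℚ.≤-refl
  run≤length ρ (i ∷ is) = if-dec (determined? f ρ) (_≤ fromℕ (suc (length is))) (λ _ → fromℕ-nonNeg (suc (length is)))
    (λ _ → 1+-lookup i (run≤length _ is))

  run-determined : ∀ {ρ} → Determined f ρ → ∀ is → run ρ is ≤ 0ℚ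
  run-determined det []       = ℚ.≤-refl
  run-determined det (i ∷ is) = if-dec (determined? f _) (_≤ 0ℚ) (λ _ → ℚ.≤-refl) (λ ¬det → contradiction det ¬det)

  -- The hypothesis `0ℚ ≤ q` covers a run that stops inside `is`.
  run-++ : ∀ ρ is js {q} → 0ℚ ≤ q → run (observe x ρ is) js ≤ q → run ρ (is ++ js) ≤ fromℕ (length is) + q
  run-++ ρ []       js 0≤q h = ℚ.≤-trans h (ℚ.≤-reflexive (sym (ℚ.+-identityˡ _)))
  run-++ ρ (i ∷ is) js {q} 0≤q h = if-dec (determined? f ρ) (_≤ fromℕ (suc (length is)) + q)
    (λ _ → ℚ.+-mono-≤ (fromℕ-nonNeg (suc (length is))) 0≤q)
    (λ _ → ℚ.≤-trans (1+-lookup i (run-++ _ is js 0≤q h)) (ℚ.≤-reflexive (sym (ℚ.+-assoc 1ℚ (fromℕ (length is)) q))))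

  -- Invariant: on the inputs consistent with `ρ`, `f` is the disjunction of the terms not yet
  -- looked at. With none left, `f` is determined to be false.
  run≤costBound : ∀ L Ts rest ρ → x ⊒ ρ → (∀ x′ → x′ ⊒ ρ → f x′ ≡ any (satisfied x′) Ts) →
                  length (concat (List.map (take L) Ts) ++ rest) ℕ.≤ n →
                  run ρ (concat (List.map (take L) Ts) ++ rest) ≤ costBound L Ts x
  run≤costBound L []       rest ρ x⊒ρ rep len = run-determined (λ y y′ y⊒ρ y′⊒ρ → trans (rep y y⊒ρ) (sym (rep y′ y′⊒ρ))) rest
  run≤costBound L (T ∷ Ts) rest ρ x⊒ρ rep len
    rewrite List.++-assoc (take L T) (concat (List.map (take L) Ts)) rest = begin
      run ρ (B ++ js)              ≤⟨ run-++ ρ B js (0≤tail (satisfied x B)) (next (satisfied x B) refl) ⟩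
      fromℕ (length B) + tail (satisfied x B) ≤⟨ ℚ.+-monoˡ-≤ _ (fromℕ-mono B≤L) ⟩
      fromℕ L + tail (satisfied x B) ∎
    where
    open ℚ.≤-Reasoning
    B = take L T
    js = concat (List.map (take L) Ts) ++ rest
    ρ′ = observe x ρ B
    tail : Bool → ℚ
    tail s = if s then penalty L T else costBound L Ts x
    B≤L : length B ℕ.≤ L
    B≤L = ℕ.≤-trans (ℕ.≤-reflexive (List.length-take L T)) (ℕ.m⊓n≤m L (length T))
    0≤tail : ∀ s → 0ℚ ≤ tail s
    0≤tail true  = penalty-nonNeg L T
    0≤tail false = costBound-nonNeg L Ts x
    js≤n : length js ℕ.≤ n
    js≤n = ℕ.≤-trans (ℕ.m≤n+m (length js) (length B)) (ℕ.≤-trans (ℕ.≤-reflexive (sym (List.length-++ B))) len)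
    next : ∀ s → satisfied x B ≡ s → run ρ′ js ≤ tail s
    next true s = if-dec (length T ℕ.≤? L) (run ρ′ js ≤_)
      -- All of `T` has been tested and is satisfied, so `f` is true on every consistent input and
      -- the run stops.
      (λ T≤L → run-determined (λ y y′ y⊒ρ′ y′⊒ρ′ → trans (f≡true T≤L y y⊒ρ′) (sym (f≡true T≤L y′ y′⊒ρ′))) js)
      (λ _ → ℚ.≤-trans (run≤length ρ′ js) (fromℕ-mono js≤n))
      where
      f≡true : length T ℕ.≤ L → ∀ y → y ⊒ ρ′ → f y ≡ true
      f≡true T≤L y y⊒ρ′ = trans (rep y (⊒-unobserve B x⊒ρ y⊒ρ′)) (cong (_∨ any (satisfied y) Ts)
        (trans (cong (satisfied y) (sym (List.take-all L T T≤L))) (trans (observe-satisfied B x⊒ρ y⊒ρ′) s)))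
    -- A falsified prefix falsifies `T`, which may therefore be dropped from the disjunction.
    next false s = run≤costBound L Ts rest ρ′ (observe-⊒ B x⊒ρ)
      (λ y y⊒ρ′ → trans (rep y (⊒-unobserve B x⊒ρ y⊒ρ′)) (cong (_∨ any (satisfied y) Ts)
        (satisfied-take L y T (trans (observe-satisfied B x⊒ρ y⊒ρ′) s)))) js≤n

-- The non-adaptive strategy

lookup-injective : {A : Set} {xs : List A} → Unique xs → ∀ i j → List.lookup xs i ≡ List.lookup xs j → i ≡ j
lookup-injective {xs = _ ∷ _}  _          zero    zero    _  = refl
lookup-injective {xs = _ ∷ _}  (_ ∷ u)    (suc i) (suc j) eq = cong suc (lookup-injective u i j eq)
lookup-injective {xs = _ ∷ xs} (x∉xs ∷ _) zero    (suc j) eq = contradiction eq (All.lookup x∉xs (∈-lookup j))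
lookup-injective {xs = _ ∷ xs} (x∉xs ∷ _) (suc i) zero    eq = contradiction (sym eq) (All.lookup x∉xs (∈-lookup i))

enumeration⇒permutation : (is : List (Fin n)) → Unique is → (∀ i → i ∈ is) →
                          Σ[ π ∈ Permutation′ n ] List.map (π ⟨$⟩ʳ_) (allFin n) ≡ is
enumeration⇒permutation {n} is u complete = resize (Perm.↔⇒≡ π)
  where
  π : Permutation (length is) n
  π = Perm.permutation (List.lookup is) (λ i → Any.index (complete i))
    (λ i → sym (Any.lookup-index (complete i)))
    (λ k → lookup-injective u _ _ (sym (Any.lookup-index (complete (List.lookup is k)))))
  -- The bijection starts from the positions of `is`; that there are `n` of them follows only from
  -- the bijection itself, so the length is generalised before it is identified.
  resize : ∀ {m} → length is ≡ m → Σ[ π ∈ Permutation m n ] List.map (π ⟨$⟩ʳ_) (allFin m) ≡ is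
  resize refl = π , trans (List.map-tabulate (λ i → i) (List.lookup is)) (List.tabulate-lookup is)

Disjoint-anti-mono : {A : Set} {xs xs′ ys ys′ : List A} →
                     (∀ {z} → z ∈ xs′ → z ∈ xs) → (∀ {z} → z ∈ ys′ → z ∈ ys) → Disjoint xs ys → Disjoint xs′ ys′
Disjoint-anti-mono xs′⊆xs ys′⊆ys xs#ys (z∈xs′ , z∈ys′) = xs#ys (xs′⊆xs z∈xs′ , ys′⊆ys z∈ys′)

-- `rest` collects the variables outside the truncated terms. Disjointness of the terms keeps the
-- whole order free of repetitions.
strategy : ∀ L (Ts : Terms n) → All Unique Ts → AllPairs Disjoint Ts →
           Σ[ π ∈ NonAdaptive n ] Σ[ rest ∈ List (Fin n) ]
             List.map (π ⟨$⟩ʳ_) (allFin n) ≡ concat (List.map (take L) Ts) ++ rest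
strategy {n} L Ts us ds = let π , eq = enumeration⇒permutation (is ++ rest) unique complete in π , rest , eq
  where
  open DecMembership (Fin._≟_ {n}) using (_∈?_)
  is = concat (List.map (take L) Ts)
  ∉is? = λ i → ¬? (i ∈? is)
  rest = filter ∉is? (allFin n)
  unique : Unique (is ++ rest)
  unique = Unique.++⁺
    (Unique.concat⁺ (All.map⁺ (All.map (Unique.take⁺ L) us))
      (AllPairs.map⁺ (AllPairs.map {R = Disjoint} {S = Disjoint on take L} (λ T#T′ → Disjoint-anti-mono (take-⊆ L) (take-⊆ L) T#T′) ds)))
    (Unique.filter⁺ ∉is? (Unique.allFin⁺ n))
    (λ (i∈is , i∈rest) → proj₂ (∈-filter⁻ ∉is? {xs = allFin n} i∈rest) i∈is)
  complete : ∀ i → i ∈ is ++ rest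
  complete i with i ∈? is
  ... | yes i∈is = ∈-++⁺ˡ i∈is
  ... | no i∉is  = ∈-++⁺ʳ is (∈-filter⁺ ∉is? (∈-allFin i) i∉is)

-- Terms of a read-once formula

T-injective : ∀ {a b} → (Bool.T a → Bool.T b) → (Bool.T b → Bool.T a) → a ≡ b
T-injective {true}  {true}  _ _ = refl
T-injective {true}  {false} f _ = contradiction (f _) λ ()
T-injective {false} {true}  _ g = contradiction (g _) λ ()
T-injective {false} {false} _ _ = refl

any-↭ : {A : Set} (p : A → Bool) {xs ys : List A} → xs ↭ ys → any p xs ≡ any p ys
any-↭ p {xs} {ys} xs↭ys = T-injective
  (Any.any⁺ p ∘ Any-resp-↭ xs↭ys ∘ Any.any⁻ p xs)
  (Any.any⁺ p ∘ Any-resp-↭ (↭-sym xs↭ys) ∘ Any.any⁻ p ys)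

-- `ReadOnce` separates distinct terms but lets one term repeat a variable. After removal of
-- repetitions, the length of a term determines its probability.
dedup : List (Fin n) → List (Fin n)
dedup = deduplicate Fin._≟_

all-dedup : (p : Fin n → Bool) (is : List (Fin n)) → all p (dedup is) ≡ all p is
all-dedup p is = T-injective (All.all-anti-mono p (∈-deduplicate⁺ Fin._≟_ {is}))
                             (All.all-anti-mono p (∈-deduplicate⁻ Fin._≟_ is))

positive-term : (x : Input n) {T : Term n} → All Positive T → ⟦ T ⟧ᵗ x ≡ satisfied x (variables T)
positive-term x []           = refl
positive-term x (pos i ∷ T⁺) = cong (lookup x i ∧_) (positive-term x T⁺)

lengthOrder : ℕ → DecTotalOrder _ _ _
lengthOrder n = On.decTotalOrder ℕ.≤-decTotalOrder (length {A = Fin n})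

module _ (φ : DNF n) (ro : ReadOnce φ) where
  open ReadOnce ro
  open import Data.List.Sort (lengthOrder n) using (sort; sort-↭; sort-↗)

  unsortedTerms sortedTerms : Terms n
  unsortedTerms = List.map (dedup ∘ variables) φ
  sortedTerms = sort unsortedTerms

  sortedTerms-represents : Represents sortedTerms ⟦ φ ⟧
  sortedTerms-represents x = sym (trans (any-↭ (satisfied x) (sort-↭ unsortedTerms)) (unsorted positive))
    where
    unsorted : ∀ {ψ} → All (All Positive) ψ → any (satisfied x) (List.map (dedup ∘ variables) ψ) ≡ ⟦ ψ ⟧ x
    unsorted []                  = refl
    unsorted {T ∷ ψ} (T⁺ ∷ ψ⁺) = cong₂ _∨_
      (trans (all-dedup (lookup x) (variables T)) (sym (positive-term x T⁺))) (unsorted ψ⁺)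

  sortedTerms-unique : All Unique sortedTerms
  sortedTerms-unique = All-resp-↭ (↭-sym (sort-↭ unsortedTerms))
    (All.map⁺ (All.universal (λ T → deduplicate-! Fin._≟_ (variables T)) φ))

  sortedTerms-disjoint : AllPairs Disjoint sortedTerms
  sortedTerms-disjoint = Permutationₛ.AllPairs-resp-↭ (setoid _) {R = Disjoint} (λ T#T′ → T#T′ ∘ swap) (resp₂ Disjoint)
    (↭⇒↭ₛ (↭-sym (sort-↭ unsortedTerms)))
    (AllPairs.map⁺ (AllPairs.map {R = Disjoint on variables} {S = Disjoint on (dedup ∘ variables)} (λ T#T′ →
      Disjoint-anti-mono (∈-deduplicate⁻ Fin._≟_ _) (∈-deduplicate⁻ Fin._≟_ _) T#T′) disjoint))

  sortedTerms-sorted : AllPairs (λ T T′ → length T ℕ.≤ length T′) sortedTerms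
  sortedTerms-sorted = Sorted.Sorted⇒AllPairs (DecTotalOrder.totalOrder (lengthOrder n)) (sort-↗ unsortedTerms)

-- Constant functions and the final estimate.

nonEmptyTerms : {f : BoolFun n} {Ts : Terms n} → Represents Ts f → ¬ Determined f untested → All (_≢ []) Ts
nonEmptyTerms {f = f} {Ts} rep ¬det = All.tabulate λ {T} T∈Ts T≡[] →
  -- An empty term is satisfied by every input and would make `f` constant.
  let f≡true : ∀ x → f x ≡ true
      f≡true x = trans (rep x) (T-injective _ λ _ →
        Any.any⁺ (satisfied x) (lose T∈Ts (subst (Bool.T ∘ satisfied x) (sym T≡[]) _)))
  in ¬det λ x x′ _ _ → trans (f≡true x) (sym (f≡true x′))

treeCost-nonNeg : {f : BoolFun n} {ρ : Outcomes n} (x : Input n) (t : Tree f ρ) → 0ℚ ≤ treeCost (replicate n 1ℚ) x t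
treeCost-nonNeg x (stop _) = ℚ.≤-refl
treeCost-nonNeg x (test i _ _ t₀ t₁) = ℚ.+-mono-≤ (ℚ.≤-trans 0≤1 (ℚ.≤-reflexive (sym (lookup-replicate i 1ℚ)))) branch
  where
  branch : 0ℚ ≤ (if lookup x i then treeCost (replicate _ 1ℚ) x t₁ else treeCost (replicate _ 1ℚ) x t₀)
  branch with lookup x i
  ... | true  = treeCost-nonNeg x t₁
  ... | false = treeCost-nonNeg x t₀

OPT-nonNeg : (f : BoolFun n) → 0ℚ ≤ OPT𝒜 f (replicate n 1ℚ) (replicate n ½)
OPT-nonNeg {n} f = begin
  0ℚ                           ≡⟨ 𝔼-const 0ℚ (untested {n}) ⟨
  𝔼[ (λ _ → 0ℚ) ∣ untested {n} ]  ≤⟨ 𝔼-mono untested (λ x _ → treeCost-nonNeg x t) ⟩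
  𝔼[ (λ x → treeCost (replicate n 1ℚ) x t) ∣ untested ] ≡⟨ 𝔼≡𝔼[∣untested] (λ x → treeCost (replicate n 1ℚ) x t) ⟨
  OPT𝒜 f (replicate n 1ℚ) (replicate n ½) ∎
  where
  open ℚ.≤-Reasoning
  t = optimal f (replicate n 1ℚ) (replicate n ½)

cost𝒩≤ : ∀ L → n ℕ.≤ 2 ℕ.^ L → (φ : DNF n) → ReadOnce φ →
          Σ[ S ∈ NonAdaptive n ] cost𝒩 ⟦ φ ⟧ (replicate n 1ℚ) (replicate n ½) S
                                  ≤ fromℕ (suc L) * OPT𝒜 ⟦ φ ⟧ (replicate n 1ℚ) (replicate n ½)
cost𝒩≤ {n} L n≤2^L φ ro = S , bound (determined? f untested)
  where
  open ℚ.≤-Reasoning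
  f = ⟦ φ ⟧
  Ts = sortedTerms φ ro
  rep = sortedTerms-represents φ ro
  us = sortedTerms-unique φ ro
  ds = sortedTerms-disjoint φ ro
  S = proj₁ (strategy L Ts us ds)
  rest = proj₁ (proj₂ (strategy L Ts us ds))
  order : List.map (S ⟨$⟩ʳ_) (allFin n) ≡ concat (List.map (take L) Ts) ++ rest
  order = proj₂ (proj₂ (strategy L Ts us ds))
  opt = OPT𝒜 f (replicate n 1ℚ) (replicate n ½)
  cost : Input n → ℚ
  cost x = run f x untested (List.map (S ⟨$⟩ʳ_) (allFin n))
  order≤n : length (concat (List.map (take L) Ts) ++ rest) ℕ.≤ n
  order≤n = ℕ.≤-reflexive (trans (cong length (sym order))
    (trans (List.length-map (S ⟨$⟩ʳ_) (allFin n)) (List.length-tabulate {n = n} (λ i → i))))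
  cost≤costBound : ∀ x → cost x ≤ costBound L Ts x
  cost≤costBound x = subst (λ is → run f x untested is ≤ costBound L Ts x) (sym order)
    (run≤costBound f x L Ts rest untested (untested-⊒ x) (λ x′ _ → rep x′) order≤n)
  bound : Dec (Determined f untested) → cost𝒩 f (replicate n 1ℚ) (replicate n ½) S ≤ fromℕ (suc L) * opt
  bound (yes det) = begin
    𝔼 (replicate n ½) cost          ≡⟨ 𝔼≡𝔼[∣untested] cost ⟩
    𝔼[ cost ∣ untested ]            ≤⟨ 𝔼-mono untested (λ x _ → run-determined f x det (List.map (S ⟨$⟩ʳ_) (allFin n))) ⟩
    𝔼[ (λ _ → 0ℚ) ∣ untested {n} ]  ≡⟨ 𝔼-const 0ℚ (untested {n}) ⟩
    0ℚ                              ≤⟨ *-nonNeg (fromℕ-nonNeg (suc L)) (OPT-nonNeg f) ⟩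
    fromℕ (suc L) * opt             ∎
  bound (no ¬det) = begin
    𝔼 (replicate n ½) cost          ≡⟨ 𝔼≡𝔼[∣untested] cost ⟩
    𝔼[ cost ∣ untested ]            ≤⟨ 𝔼-mono untested (λ x _ → cost≤costBound x) ⟩
    𝔼[ costBound L Ts ∣ untested ]  ≤⟨ 𝔼-costBound L n≤2^L us ds ⟩
    fromℕ (suc L) * V Ts            ≤⟨ *-mono-nonNegˡ (fromℕ-nonNeg (suc L))
                                         (V≤OPT rep (nonEmptyTerms rep ¬det) us ds (sortedTerms-sorted φ ro)) ⟩
    fromℕ (suc L) * opt             ∎

theorem1 :
    Σ[ C ∈ ℚ ] (0ℚ < C ×
      ((n : ℕ) → 2 ℕ.≤ n → (φ : DNF n) → ReadOnce φ →
        let f = ⟦ φ ⟧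
            c = replicate n 1ℚ
            p = replicate n ½
        in Σ[ S ∈ NonAdaptive n ] (cost𝒩 f c p S ≤ C * OPT𝒜 f c p ·log₂ n)))
-- The truncation length is L = k + 1, the exponent for which n ≤ 2^L. The factor L + 1 = k + 2 is
-- then at most three times the logarithm.
theorem1 = fromℕ 3 , ℚ.positive⁻¹ (fromℕ 3) , λ n 2≤n φ ro →
  let k , 2^k≤n , n≤2^k+1 = 2^-bracket n 2≤n
      S , cost≤ = cost𝒩≤ (suc k) n≤2^k+1 φ ro
  in S , λ a b n^b≤2^a → ℚ.≤-trans cost≤ (fromℕ≤3·log₂ k 2≤n 2^k≤n (OPT-nonNeg ⟦ φ ⟧) a b n^b≤2^a)
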